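{- The P-GLCP reduces to the P-LCP in strongly polynomial time. That is, there is a strongly polynomial procedure that transforms every P-GLCP$(M,q)$ into a P-LCP$(M',q')$ such that from the unique solution of the P-LCP$(M',q')$ the unique solution of the P-GLCP$(M,q)$ can be computed in strongly polynomial time.
   Context: A block matrix of type $b=(b_1,\dots,b_n)$ ($b_j$ positive integers) is a real $m\times n$ matrix $M$, $m=\sum_jb_j$, whose rows are partitioned into $n$ consecutive blocks, block $j$ having $b_j$ rows. A representative submatrix is an $n\times n$ matrix obtained by choosing one row from each block (in block order). A square matrix is a P-matrix if all its principal minors are positive; a block matrix is a P-matrix if every representative submatrix is. GLCP$(M,q)$ of type $b$, $q\in\mathbb R^m$: find $z\in\mathbb R^n$ and a block vector $w\in\mathbb R^m$ of type $b$ with $w-Mz=q$, $w,z\ge\mathbf 0$, and $z_j\prod_{i=1}^{b_j}w^j_i=0$ for all $j=1,\dots,n$. A P-GLCP is a GLCP whose matrix $M$ is a block P-matrix; it has exactly one solution. A P-LCP is a P-GLCP of type $(1,\dots,1)$. A procedure is strongly polynomial if its number of arithmetic operations (including comparisons) is bounded by a polynomial in $m$ and $n$. -}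

module Defs where

open import Algebra.Core using (Op₁; Op₂)
open import Algebra.Bundles using (CommutativeRing; Semiring)
open import Algebra.Structures using (IsCommutativeRing)
open import Data.Bool.Base using (Bool; if_then_else_)
open import Data.Fin.Base as Fin using (Fin; zero; suc; toℕ; punchIn)
open import Data.List.Base using (List; []; _∷_)
open import Data.List.Properties using (≡-dec)
open import Data.Nat.Base as ℕ using (ℕ; zero; suc)
import Data.Nat.Properties as ℕ
open import Data.Product.Base using (_×_; ∃; proj₁)
open import Data.Vec.Functional using (Vector; foldr)
open import Level using (_⊔_) renaming (suc to lsuc)
open import Relation.Binary.Core using (Rel)
open import Relation.Binary.Definitions using (tri<; tri≈; tri>)
open import Relation.Binary.Structures using (IsStrictTotalOrder)
import Relation.Binary.Construct.StrictToNonStrict as ToNonStrict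
open import Relation.Nullary using (¬_)
open import Relation.Nullary.Decidable using (does)

------------------------------------------------------------------------
-- Scalars

-- The real numbers enter only as an ordered field; classically, ℝ with its
-- usual order is an instance.  Since the order is a strict total order,
-- comparisons are decidable, which makes them available as machine
-- operations below.
record OrderedField c ℓ₁ ℓ₂ : Set (lsuc (c ⊔ ℓ₁ ⊔ ℓ₂)) where
  infix  8 -_
  infixl 7 _*_
  infixl 6 _+_ _-_
  infix  4 _≈_ _<_ _≤_
  field
    Carrier            : Set c
    _≈_                : Rel Carrier ℓ₁
    _<_                : Rel Carrier ℓ₂
    _+_                : Op₂ Carrier
    _*_                : Op₂ Carrier
    -_                 : Op₁ Carrier
    0#                 : Carrier
    1#                 : Carrier
    isCommutativeRing  : IsCommutativeRing _≈_ _+_ _*_ -_ 0# 1#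
    isStrictTotalOrder : IsStrictTotalOrder _≈_ _<_
    0<1                : 0# < 1#
    +-monoˡ-<          : ∀ z {x y} → x < y → x + z < y + z
    *-positive         : ∀ {x y} → 0# < x → 0# < y → 0# < x * y
    inverse            : ∀ x → ¬ (x ≈ 0#) → ∃ λ y → x * y ≈ 1#

  open IsStrictTotalOrder isStrictTotalOrder public using (compare; _<?_)

  commutativeRing : CommutativeRing c ℓ₁
  commutativeRing = record { isCommutativeRing = isCommutativeRing }

  _≤_ : Rel Carrier (ℓ₁ ⊔ ℓ₂)
  _≤_ = ToNonStrict._≤_ _≈_ _<_

  _-_ : Op₂ Carrier
  x - y = x + - y

  -- Division by zero yields zero.
  divide : Op₂ Carrier
  divide x y with compare y 0#
  ... | tri< _ y≉0 _ = x * proj₁ (inverse y y≉0)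
  ... | tri≈ _ _   _ = 0#
  ... | tri> _ y≉0 _ = x * proj₁ (inverse y y≉0)

------------------------------------------------------------------------
-- Polynomials in two variables

-- Natural coefficients suffice for upper bounds on numbers of operations.
data Poly : Set where
  con       : ℕ → Poly
  var₁ var₂ : Poly
  _⊞_ _⊠_   : Poly → Poly → Poly

evalPoly : Poly → ℕ → ℕ → ℕ
evalPoly (con k) x y = k
evalPoly var₁    x y = x
evalPoly var₂    x y = y
evalPoly (p ⊞ r) x y = evalPoly p x y ℕ.+ evalPoly r x y
evalPoly (p ⊠ r) x y = evalPoly p x y ℕ.* evalPoly r x y

------------------------------------------------------------------------
-- Programs

-- A program is one fixed text, for all sizes n, all types b and all data.
-- It works on two memories, one holding naturals (for indices and control)
-- and one holding scalars; both are addressed by finite tuples of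
-- naturals, so that [ a , i , j ] plays the role of entry (i , j) of the
-- array a.  Scalars never flow into the natural memory: they can be
-- inspected only by comparison.
data NatExp : Set where
  lit     : ℕ → NatExp
  cell    : List NatExp → NatExp
  _⊕_ _⊖_ : NatExp → NatExp → NatExp

data ArithOp : Set where
  add sub mul div : ArithOp

data ScalarExp : Set where
  zero one : ScalarExp
  copy     : List NatExp → ScalarExp
  arith    : ArithOp → List NatExp → List NatExp → ScalarExp

infixl 6 _⊕_ _⊖_
infixr 3 _⨾_
infix  4 _≔_ _←_ ifNat_<_then_else_ ifScalar_<_then_else_ for_below_repeat_

-- The bound of a for-loop is evaluated on entry; the loop variable x is
-- the natural cell with address [ x ].  A while-loop that is known to stop
-- within a given number of rounds is a for-loop with a conditional body.
data Program : Set where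
  skip : Program
  _⨾_  : Program → Program → Program
  _≔_  : List NatExp → NatExp → Program
  _←_  : List NatExp → ScalarExp → Program
  ifNat_<_then_else_    : NatExp → NatExp → Program → Program → Program
  ifScalar_<_then_else_ : List NatExp → List NatExp → Program → Program → Program
  for_below_repeat_     : ℕ → NatExp → Program → Program

------------------------------------------------------------------------

module Over {c ℓ₁ ℓ₂} (F : OrderedField c ℓ₁ ℓ₂) where

  open OrderedField F
  open import Algebra.Definitions.RawSemiring
    (Semiring.rawSemiring (CommutativeRing.semiring commutativeRing))
    using (sum; product; _^_)

  ----------------------------------------------------------------------
  -- P-matrices

  Matrix : ℕ → ℕ → Set c
  Matrix r s = Fin r → Fin s → Carrier

  -- Laplace expansion along the first row.
  det : ∀ {n} → Matrix n n → Carrier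
  det {zero}  A = 1#
  det {suc n} A = sum λ k →
    (- 1#) ^ toℕ k * (A zero k * det (λ i j → A (suc i) (punchIn k j)))

  -- The index set of a principal minor is given by its increasing
  -- enumeration α; the empty minor, which is 1, is harmlessly included.
  IsPMatrix : ∀ {n} → Matrix n n → Set ℓ₂
  IsPMatrix {n} A = ∀ {k} (α : Fin k → Fin n) →
    (∀ {i j} → i Fin.< j → α i Fin.< α j) →
    0# < det (λ i j → A (α i) (α j))

  -- M j i is the i-th row of the j-th block, and the blocks are listed one
  -- after the other.
  BlockMatrix : ∀ {n} → (Fin n → ℕ) → Set c
  BlockMatrix {n} b = (j : Fin n) → Matrix (b j) n

  BlockVector : ∀ {n} → (Fin n → ℕ) → Set c
  BlockVector b = ∀ j → Vector Carrier (b j)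

  representative : ∀ {n} {b : Fin n → ℕ} →
    BlockMatrix b → (∀ j → Fin (b j)) → Matrix n n
  representative M ρ j = M j (ρ j)

  IsBlockPMatrix : ∀ {n} {b : Fin n → ℕ} → BlockMatrix b → Set ℓ₂
  IsBlockPMatrix {b = b} M =
    (ρ : ∀ j → Fin (b j)) → IsPMatrix (representative M ρ)

  ----------------------------------------------------------------------
  -- The generalized linear complementarity problem

  record IsSolution {n} {b : Fin n → ℕ} (M : BlockMatrix b)
      (q : BlockVector b) (w : BlockVector b) (z : Vector Carrier n)
      : Set (ℓ₁ ⊔ ℓ₂) where
    field
      equation        : ∀ j i → w j i - sum (λ k → M j i k * z k) ≈ q j i
      w-nonnegative   : ∀ j i → 0# ≤ w j i
      z-nonnegative   : ∀ j → 0# ≤ z j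
      complementarity : ∀ j → z j * product (w j) ≈ 0#

  IsUniqueSolution : ∀ {n} {b : Fin n → ℕ} → BlockMatrix b →
    BlockVector b → BlockVector b → Vector Carrier n → Set (c ⊔ ℓ₁ ⊔ ℓ₂)
  IsUniqueSolution M q w z = IsSolution M q w z ×
    (∀ w₂ z₂ → IsSolution M q w₂ z₂ →
      (∀ j i → w₂ j i ≈ w j i) × (∀ j → z₂ j ≈ z j))

  -- An LCP of order n is a GLCP of this type.
  ones : ∀ {n} → Fin n → ℕ
  ones _ = 1

  ----------------------------------------------------------------------
  -- Execution of programs

  record State : Set c where
    constructor ⟨_,_⟩
    field
      nats    : List ℕ → ℕ
      scalars : List ℕ → Carrier
  open State public

  update : ∀ {a} {A : Set a} → (List ℕ → A) → List ℕ → A → List ℕ → A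
  update μ x v y = if does (≡-dec ℕ._≟_ x y) then v else μ y

  evalNat  : State → NatExp → ℕ
  evalAddr : State → List NatExp → List ℕ

  evalNat σ (lit k)  = k
  evalNat σ (cell a) = nats σ (evalAddr σ a)
  evalNat σ (d ⊕ e)  = evalNat σ d ℕ.+ evalNat σ e
  evalNat σ (d ⊖ e)  = evalNat σ d ℕ.∸ evalNat σ e

  evalAddr σ []      = []
  evalAddr σ (e ∷ a) = evalNat σ e ∷ evalAddr σ a

  apply : ArithOp → Op₂ Carrier
  apply add = _+_
  apply sub = _-_
  apply mul = _*_
  apply div = divide

  evalScalar : State → ScalarExp → Carrier
  evalScalar σ zero           = 0#
  evalScalar σ one            = 1#
  evalScalar σ (copy a)       = scalars σ (evalAddr σ a)
  evalScalar σ (arith op a d) =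
    apply op (scalars σ (evalAddr σ a)) (scalars σ (evalAddr σ d))

  setNat : List ℕ → ℕ → State → State
  setNat x k σ = ⟨ update (nats σ) x k , scalars σ ⟩

  setScalar : List ℕ → Carrier → State → State
  setScalar x v σ = ⟨ nats σ , update (scalars σ) x v ⟩

  natTest : State → NatExp → NatExp → Bool
  natTest σ d e = does (evalNat σ d ℕ.<? evalNat σ e)

  scalarTest : State → List NatExp → List NatExp → Bool
  scalarTest σ a d =
    does (scalars σ (evalAddr σ a) <? scalars σ (evalAddr σ d))

  run  : Program → State → State
  loop : ℕ → Program → ℕ → State → State

  run skip σ                            = σ
  run (P ⨾ Q) σ                         = run Q (run P σ)
  run (a ≔ e) σ                         = setNat (evalAddr σ a) (evalNat σ e) σ
  run (a ← e) σ                         =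
    setScalar (evalAddr σ a) (evalScalar σ e) σ
  run (ifNat d < e then P else Q) σ     =
    if natTest σ d e then run P σ else run Q σ
  run (ifScalar a < d then P else Q) σ  =
    if scalarTest σ a d then run P σ else run Q σ
  run (for x below e repeat P) σ            = loop x P (evalNat σ e) σ

  -- Rounds 0, …, k - 1, in this order.
  loop x P zero    σ = σ
  loop x P (suc k) σ = run P (setNat (x ∷ []) k (loop x P k σ))

  -- Every executed assignment and test counts, on naturals as well as on
  -- scalars, and so does every round of a loop.  The evaluation of an
  -- expression needs no separate count: its length is fixed by the program
  -- text.
  cost     : Program → State → ℕ
  loopCost : ℕ → Program → ℕ → State → ℕ

  cost skip σ                           = 0
  cost (P ⨾ Q) σ                        = cost P σ ℕ.+ cost Q (run P σ)
  cost (a ≔ e) σ                        = 1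
  cost (a ← e) σ                        = 1
  cost (ifNat d < e then P else Q) σ    =
    1 ℕ.+ (if natTest σ d e then cost P σ else cost Q σ)
  cost (ifScalar a < d then P else Q) σ =
    1 ℕ.+ (if scalarTest σ a d then cost P σ else cost Q σ)
  cost (for x below e repeat P) σ           = 1 ℕ.+ loopCost x P (evalNat σ e) σ

  loopCost x P zero    σ = 0
  loopCost x P (suc k) σ = loopCost x P k σ ℕ.+
    (1 ℕ.+ cost P (setNat (x ∷ []) k (loop x P k σ)))

  ----------------------------------------------------------------------
  -- Input and output

  at : ∀ {a} {A : Set a} {n} → A → Vector A n → ℕ → A
  at {n = zero}  d v i       = d
  at {n = suc n} d v zero    = v zero
  at {n = suc n} d v (suc i) = at d (λ k → v (suc k)) i

  -- All cells not mentioned hold zero.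
  --   naturals:  [ 0 ] ↦ n,  [ 0 , j ] ↦ b j
  --   scalars:   [ 0 , j , i , k ] ↦ M j i k,  [ 1 , j , i ] ↦ q j i
  instanceNats : ∀ {n} → (Fin n → ℕ) → List ℕ → ℕ
  instanceNats {n} b (0 ∷ [])     = n
  instanceNats     b (0 ∷ j ∷ []) = at 0 b j
  instanceNats     b _            = 0

  instanceScalars : ∀ {n} {b : Fin n → ℕ} →
    BlockMatrix b → BlockVector b → List ℕ → Carrier
  instanceScalars M q (0 ∷ j ∷ i ∷ k ∷ []) =
    at 0# (λ j′ → at 0# (λ i′ → at 0# (M j′ i′) k) i) j
  instanceScalars M q (1 ∷ j ∷ i ∷ [])     = at 0# (λ j′ → at 0# (q j′) i) j
  instanceScalars M q _                    = 0#

  initial : ∀ {n} {b : Fin n → ℕ} → BlockMatrix b → BlockVector b → State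
  initial {b = b} M q = ⟨ instanceNats b , instanceScalars M q ⟩

  --   naturals:  [ 2 ] ↦ order of the LCP
  --   scalars:   [ 2 , i , k ] ↦ its matrix,  [ 3 , i ] ↦ its right-hand side
  lcpOrder : State → ℕ
  lcpOrder σ = nats σ (2 ∷ [])

  lcpMatrix : (σ : State) → BlockMatrix (ones {lcpOrder σ})
  lcpMatrix σ i _ k = scalars σ (2 ∷ toℕ i ∷ toℕ k ∷ [])

  lcpVector : (σ : State) → BlockVector (ones {lcpOrder σ})
  lcpVector σ i _ = scalars σ (3 ∷ toℕ i ∷ [])

  -- The GLCP instance together with a solution of the LCP:
  --   naturals:  additionally [ 2 ] ↦ order of the LCP
  --   scalars:   additionally [ 4 , i ] ↦ w′ i,  [ 5 , i ] ↦ z′ i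
  withSolution : ∀ {n} {b : Fin n → ℕ} → BlockMatrix b → BlockVector b →
    ∀ {n′} → BlockVector (ones {n′}) → Vector Carrier n′ → State
  withSolution {b = b} M q {n′} w′ z′ = ⟨ ν , s ⟩
    where
    ν : List ℕ → ℕ
    ν (2 ∷ []) = n′
    ν x        = instanceNats b x

    s : List ℕ → Carrier
    s (4 ∷ i ∷ []) = at 0# (λ k → w′ k zero) i
    s (5 ∷ i ∷ []) = at 0# z′ i
    s x            = instanceScalars M q x

  --   scalars:   [ 6 , j , i ] ↦ w j i,  [ 7 , j ] ↦ z j
  outputW : ∀ {n} {b : Fin n → ℕ} → State → BlockVector b
  outputW σ j i = scalars σ (6 ∷ toℕ j ∷ toℕ i ∷ [])

  outputZ : ∀ {n} → State → Vector Carrier n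
  outputZ σ j = scalars σ (7 ∷ toℕ j ∷ [])

  ----------------------------------------------------------------------
  -- Strongly polynomial reductions

  rows : ∀ {n} → (Fin n → ℕ) → ℕ
  rows = foldr ℕ._+_ 0

  -- The transformation runs within the bound p in m and n on (M , q) and
  -- its output is a P-LCP.
  Transforms : Program → Poly → ∀ {n} {b : Fin n → ℕ} →
    BlockMatrix b → BlockVector b → Set ℓ₂
  Transforms T p {n} {b} M q =
    cost T (initial M q) ℕ.≤ evalPoly p (rows b) n ×
    IsBlockPMatrix (lcpMatrix (run T (initial M q)))

  -- From the unique solution of that P-LCP, the second program computes
  -- within the bound p in m and n the unique solution of the GLCP.
  Recovers : Program → Program → Poly → ∀ {n} {b : Fin n → ℕ} →
    BlockMatrix b → BlockVector b → Set (c ⊔ ℓ₁ ⊔ ℓ₂)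
  Recovers T R p {n} {b} M q =
    let σ = run T (initial M q) in
    ∀ w′ z′ → IsUniqueSolution (lcpMatrix σ) (lcpVector σ) w′ z′ →
    let τ = withSolution M q w′ z′ in
    cost R τ ℕ.≤ evalPoly p (rows b) n ×
    IsUniqueSolution M q (outputW (run R τ)) (outputZ (run R τ))

module Submission where

-- Complementarity in block j says min (z_j, w^j_1, …, w^j_{b_j}) = 0.  The
-- minimum over a block is found one row at a time: a row of value w lowers the
-- current minimum x to x - s, where s ≥ 0, τ = w - x + s ≥ 0 and s τ = 0.
-- One variable s per row of M, together with z, gives an LCP of order m + n
--
--   τ_p = (M_p - M_{j,1}) z + q_p - q_{j,1} + Σ s_r   (r ≤ p in block j, p in block j)
--   u_j = M_{j,1} z + q_{j,1} - Σ s_r                 (r in block j)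
--
-- with pairs (s_p , τ_p) and (z_j , u_j).  Its matrix is a P-matrix: the pivot of
-- s_1 is 1, and the Schur complement is the same matrix with s_1 left out and
-- row 1 of M as the starting row of its block, so all principal minors are
-- principal minors of representative submatrices of M.  Every solution of the
-- GLCP extends to one of the LCP, so that uniqueness carries over.

open import Defs
open import Algebra.Bundles using (CommutativeMonoid; CommutativeRing; Semiring)
open import Algebra.Solver.Ring.AlmostCommutativeRing using (fromCommutativeRing; _-Raw-AlmostCommutative⟶_)
open import Data.Bool.Base using (true; false; if_then_else_)
open import Data.Empty using (⊥)
open import Data.Fin.Base as Fin using (Fin; zero; suc; toℕ; punchIn; pinch; splitAt; _↑ˡ_; _↑ʳ_)
import Data.Fin.Properties as Fin
open import Data.Integer.Base as ℤ using (ℤ; +_; -[1+_]; +[1+_])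
import Data.Integer.Properties as ℤ
open import Data.List.Base using (List; []; _∷_)
import Data.List.Properties as List
open import Data.Maybe.Base using (Maybe; map)
open import Data.Nat.Base as ℕ using (ℕ; zero; suc; z≤n; s≤s; NonZero)
import Data.Nat.Properties as ℕ
open import Data.Product.Base using (∃; Σ-syntax; _×_; _,_; proj₁; proj₂)
open import Data.Sum.Base as Sum using (_⊎_; inj₁; inj₂; [_,_]′)
open import Data.Unit.Base using (⊤; tt)
open import Data.Vec.Functional using (Vector; updateAt) renaming (_∷_ to _∷ᵥ_)
open import Data.Vec.Functional.Properties using (updateAt-updates; updateAt-minimal)
open import Function.Base using (_∘_; id)
import Level
open import Relation.Binary.Definitions using (tri<; tri≈; tri>)
open import Relation.Binary.PropositionalEquality using (_≡_; _≢_; refl; cong; cong₂; subst; subst₂)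
  renaming (sym to ≡-sym; trans to ≡-trans)
import Relation.Binary.Reasoning.Setoid as SetoidReasoning
open import Relation.Binary.Structures using (IsStrictTotalOrder)
open import Relation.Nullary using (¬_; yes; no; contradiction)
open import Relation.Nullary.Decidable using (dec⇒maybe; does)
open import Relation.Nullary.Reflects using (ofʸ; ofⁿ)

-- The obstacle is that the entries of the LCP must be written down without knowing which row of a
-- block is active. Serial minima avoid this choice: every comparison of values is left to one
-- complementary pair, so the entries are 0, 1, -1, entries of `M` and differences of such entries,
-- and neither program divides or compares scalars. The first row of a block gets a pair of its own
-- as well, so that all m rows are treated alike and the order is m + n. Pivoting changes the
-- starting rows and both pivoting and deletion shorten the list of auxiliary variables. The
-- P-property is therefore proved for arbitrary starting rows `ρ` and an arbitrary list `t` of rows,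
-- although the programs compute only one instance. All pivots are 1, so the determinant theory is
-- confined to adding multiples of the first column.

module RingProperties {c ℓ₁ ℓ₂} (F : OrderedField c ℓ₁ ℓ₂) where

  open OrderedField F using (commutativeRing)
  open CommutativeRing commutativeRing public hiding (refl; zero)
  open CommutativeRing commutativeRing public using () renaming (refl to ≈-refl)
  open import Algebra.Properties.Ring ring public
  open import Algebra.Properties.Semiring.Sum semiring public
  open import Algebra.Properties.Semiring.Mult.TCOptimised semiring
    using (×-homo-+; ×1-homo-*; 1+×) renaming (_×_ to _·_)
  open import Relation.Binary.Reasoning.Setoid setoid

  x-y≈x : ∀ {x y} → y ≈ 0# → x - y ≈ x
  x-y≈x y≈0 = trans (+-congˡ (trans (-‿cong y≈0) -0#≈0#)) (+-identityʳ _)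

  -- The canonical ring homomorphism ℤ → Carrier, for the ring solver.
  fromℤ : ℤ → Carrier
  fromℤ (+ n)    = n · 1#
  fromℤ -[1+ n ] = - (suc n · 1#)

  fromℤ-neg : ∀ i → fromℤ (ℤ.- i) ≈ - fromℤ i
  fromℤ-neg (+ zero)  = sym -0#≈0#
  fromℤ-neg +[1+ n ]  = ≈-refl
  fromℤ-neg -[1+ n ]  = sym (-‿involutive _)

  fromℤ-⊖ : ∀ m n → fromℤ (m ℤ.⊖ n) ≈ m · 1# - n · 1#
  fromℤ-⊖ zero    zero    = sym (-‿inverseʳ 0#)
  fromℤ-⊖ zero    (suc n) = sym (+-identityˡ _)
  fromℤ-⊖ (suc m) zero    = sym (trans (+-congˡ -0#≈0#) (+-identityʳ _))
  fromℤ-⊖ (suc m) (suc n) = begin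
    fromℤ (suc m ℤ.⊖ suc n)            ≡⟨ cong fromℤ (ℤ.[1+m]⊖[1+n]≡m⊖n m n) ⟩
    fromℤ (m ℤ.⊖ n)                    ≈⟨ fromℤ-⊖ m n ⟩
    x - y                              ≈⟨ +-congʳ (xyx⁻¹≈y 1# x) ⟨
    1# + x - 1# - y                    ≈⟨ +-assoc _ _ _ ⟩
    1# + x + (- 1# - y)                ≈⟨ +-congˡ (-‿+-comm 1# y) ⟩
    1# + x - (1# + y)                  ≈⟨ +-cong (1+× m 1#) (-‿cong (1+× n 1#)) ⟨
    suc m · 1# - suc n · 1#            ∎
    where
    x = m · 1#
    y = n · 1#

  fromℤ-+ : ∀ i j → fromℤ (i ℤ.+ j) ≈ fromℤ i + fromℤ j
  fromℤ-+ (+ m)    (+ n)    = ×-homo-+ 1# m n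
  fromℤ-+ (+ m)    -[1+ n ] = fromℤ-⊖ m (suc n)
  fromℤ-+ -[1+ m ] (+ n)    = trans (fromℤ-⊖ n (suc m)) (+-comm _ _)
  fromℤ-+ i@(-[1+ m ]) j@(-[1+ n ]) = begin
    fromℤ (i ℤ.+ j)                    ≡⟨ cong fromℤ (ℤ.neg-distrib-+ +[1+ m ] +[1+ n ]) ⟨
    - fromℤ (+[1+ m ] ℤ.+ +[1+ n ])    ≈⟨ -‿cong (×-homo-+ 1# (suc m) (suc n)) ⟩
    - (suc m · 1# + suc n · 1#)        ≈⟨ -‿+-comm _ _ ⟨
    fromℤ i + fromℤ j                  ∎

  fromℤ-pos-* : ∀ m j → fromℤ (+ m ℤ.* j) ≈ fromℤ (+ m) * fromℤ j
  fromℤ-pos-* m (+ n) = begin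
    fromℤ (+ m ℤ.* + n)                ≡⟨ cong fromℤ (ℤ.pos-* m n) ⟨
    (m ℕ.* n) · 1#                     ≈⟨ ×1-homo-* m n ⟩
    m · 1# * n · 1#                    ∎
  fromℤ-pos-* m j@(-[1+ n ]) = begin
    fromℤ (+ m ℤ.* j)                  ≡⟨ cong fromℤ (ℤ.neg-distribʳ-* (+ m) +[1+ n ]) ⟨
    fromℤ (ℤ.- (+ m ℤ.* +[1+ n ]))     ≈⟨ fromℤ-neg (+ m ℤ.* +[1+ n ]) ⟩
    - fromℤ (+ m ℤ.* +[1+ n ])         ≈⟨ -‿cong (fromℤ-pos-* m +[1+ n ]) ⟩
    - (m · 1# * suc n · 1#)            ≈⟨ -‿distribʳ-* _ _ ⟩
    m · 1# * - (suc n · 1#)            ∎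

  fromℤ-* : ∀ i j → fromℤ (i ℤ.* j) ≈ fromℤ i * fromℤ j
  fromℤ-* (+ m)        j = fromℤ-pos-* m j
  fromℤ-* i@(-[1+ m ]) j = begin
    fromℤ (i ℤ.* j)                    ≡⟨ cong fromℤ (ℤ.neg-distribˡ-* +[1+ m ] j) ⟨
    fromℤ (ℤ.- (+[1+ m ] ℤ.* j))       ≈⟨ fromℤ-neg (+[1+ m ] ℤ.* j) ⟩
    - fromℤ (+[1+ m ] ℤ.* j)           ≈⟨ -‿cong (fromℤ-pos-* (suc m) j) ⟩
    - (suc m · 1# * fromℤ j)           ≈⟨ -‿distribˡ-* _ _ ⟩
    - (suc m · 1#) * fromℤ j           ∎

  fromℤ-homomorphism : ℤ.+-*-rawRing -Raw-AlmostCommutative⟶ fromCommutativeRing commutativeRing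
  fromℤ-homomorphism = record
    { ⟦_⟧    = fromℤ
    ; +-homo = fromℤ-+
    ; *-homo = fromℤ-*
    ; -‿homo = fromℤ-neg
    ; 0-homo = ≈-refl
    ; 1-homo = ≈-refl
    }

  fromℤ-≟ : ∀ i j → Maybe (fromℤ i ≈ fromℤ j)
  fromℤ-≟ i j = map (λ i≡j → reflexive (cong fromℤ i≡j)) (dec⇒maybe (i ℤ.≟ j))

  open import Algebra.Solver.Ring ℤ.+-*-rawRing
    (fromCommutativeRing commutativeRing) fromℤ-homomorphism fromℤ-≟ public
    using (solve; con; _:=_; _:+_; _:*_; _:-_; :-_)

-- Signs and vanishing products in an ordered field

module OrderProperties {c ℓ₁ ℓ₂} (F : OrderedField c ℓ₁ ℓ₂) where

  open OrderedField F using
    ( _<_; _≤_; 0<1; +-monoˡ-<; *-positive; inverse; compare; isStrictTotalOrder)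
  open RingProperties F
  open import Algebra.Definitions.RawSemiring (Semiring.rawSemiring semiring) using (product)
  open IsStrictTotalOrder isStrictTotalOrder public
    using (<-respʳ-≈; <-respˡ-≈) renaming (trans to <-trans; irrefl to <-irrefl)

  ≤-respʳ-≈ : ∀ {x y z} → y ≈ z → x ≤ y → x ≤ z
  ≤-respʳ-≈ y≈z (inj₁ x<y) = inj₁ (<-respʳ-≈ y≈z x<y)
  ≤-respʳ-≈ y≈z (inj₂ x≈y) = inj₂ (trans x≈y y≈z)

  +-positive-nonnegative : ∀ {x y} → 0# < x → 0# ≤ y → 0# < x + y
  +-positive-nonnegative {x} {y} 0<x (inj₁ 0<y) =
    <-trans 0<y (<-respˡ-≈ (+-identityˡ y) (+-monoˡ-< y 0<x))
  +-positive-nonnegative {x} {y} 0<x (inj₂ 0≈y) =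
    <-respʳ-≈ (trans (sym (+-identityʳ x)) (+-congˡ 0≈y)) 0<x

  +-nonnegative : ∀ {x y} → 0# ≤ x → 0# ≤ y → 0# ≤ x + y
  +-nonnegative (inj₁ 0<x) 0≤y = inj₁ (+-positive-nonnegative 0<x 0≤y)
  +-nonnegative {x} {y} (inj₂ 0≈x) 0≤y =
    ≤-respʳ-≈ (trans (sym (+-identityˡ y)) (+-congʳ 0≈x)) 0≤y

  x+y≈0⇒x≈0 : ∀ {x y} → 0# ≤ x → 0# ≤ y → x + y ≈ 0# → x ≈ 0#
  x+y≈0⇒x≈0 (inj₁ 0<x) 0≤y x+y≈0 =
    contradiction (+-positive-nonnegative 0<x 0≤y) (<-irrefl (sym x+y≈0))
  x+y≈0⇒x≈0 (inj₂ 0≈x) 0≤y x+y≈0 = sym 0≈x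

  x<y⇒0<y-x : ∀ {x y} → x < y → 0# < y - x
  x<y⇒0<y-x {x} x<y = <-respˡ-≈ (-‿inverseʳ x) (+-monoˡ-< (- x) x<y)

  *-integral : ∀ {x y} → x * y ≈ 0# → x ≈ 0# ⊎ y ≈ 0#
  *-integral {x} {y} xy≈0 with IsStrictTotalOrder._≟_ isStrictTotalOrder x 0#
  ... | yes x≈0 = inj₁ x≈0
  ... | no  x≉0 with inverse x x≉0
  ...   | x⁻¹ , xx⁻¹≈1 = inj₂ (begin
    y               ≈⟨ *-identityˡ y ⟨
    1# * y          ≈⟨ *-congʳ xx⁻¹≈1 ⟨
    x * x⁻¹ * y     ≈⟨ solve 3 (λ a b d → a :* b :* d := b :* (a :* d)) ≈-refl x x⁻¹ y ⟩
    x⁻¹ * (x * y)   ≈⟨ *-congˡ xy≈0 ⟩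
    x⁻¹ * 0#        ≈⟨ zeroʳ x⁻¹ ⟩
    0#              ∎)
    where open SetoidReasoning setoid

  1≈0-elim : ∀ {a} {A : Set a} → 1# ≈ 0# → A
  1≈0-elim 1≈0 = contradiction 0<1 (<-irrefl (sym 1≈0))

  product≈0 : ∀ {n} (v : Fin n → Carrier) → product v ≈ 0# → ∃ λ i → v i ≈ 0#
  product≈0 {zero}  v 1≈0 = 1≈0-elim 1≈0
  product≈0 {suc n} v vΠ≈0 with *-integral vΠ≈0
  ... | inj₁ v₀≈0 = zero , v₀≈0
  ... | inj₂ Π≈0  with product≈0 (λ i → v (suc i)) Π≈0
  ...   | i , vᵢ≈0 = suc i , vᵢ≈0

  product-zero : ∀ {n} (v : Fin n → Carrier) i → v i ≈ 0# → product v ≈ 0#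
  product-zero v zero    v₀≈0 = trans (*-congʳ v₀≈0) (zeroˡ _)
  product-zero v (suc i) vᵢ≈0 =
    trans (*-congˡ (product-zero (λ k → v (suc k)) i vᵢ≈0)) (zeroʳ _)

-- Determinants: column operations and the Schur complement

-- pinch r k is the index of column k once column punchIn k r has been deleted.
punchIn-pinch : ∀ {n} (k : Fin (suc (suc n))) (r : Fin (suc n)) →
  punchIn (punchIn k r) (pinch r k) ≡ k
punchIn-pinch zero    r       = refl
punchIn-pinch (suc k) zero    = refl
punchIn-pinch {suc n} (suc k) (suc r) = cong suc (punchIn-pinch k r)

-- Needed to compare minors of minors: erasing two columns in either order leaves the others in the
-- same places.
punchIn-punchIn : ∀ {n} (k : Fin (suc (suc n))) (r : Fin (suc n)) (j : Fin n) →
  punchIn (punchIn k r) (punchIn (pinch r k) j) ≡ punchIn k (punchIn r j)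
punchIn-punchIn zero    r       j       = refl
punchIn-punchIn (suc k) zero    j       = refl
punchIn-punchIn {suc n} (suc k) (suc r) zero    = refl
punchIn-punchIn {suc n} (suc k) (suc r) (suc j) = cong suc (punchIn-punchIn k r j)

module Determinant {c ℓ₁ ℓ₂} (F : OrderedField c ℓ₁ ℓ₂) where

  open RingProperties F
  open Over F
  open import Algebra.Definitions.RawSemiring (Semiring.rawSemiring semiring) using (_^_)
  open SetoidReasoning setoid

  sign : ∀ {n} → Fin n → Carrier
  sign k = (- 1#) ^ toℕ k

  minor : ∀ {n} → Matrix (suc n) (suc n) → Fin (suc n) → Matrix n n
  minor A k i j = A (suc i) (punchIn k j)

  term : ∀ {n} → Matrix (suc n) (suc n) → Fin (suc n) → Carrier
  term A k = sign k * (A zero k * det (minor A k))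

  -- If r < k, the exponents on the left are r and k - 1, otherwise r + 1 and k; either sum has the
  -- parity of k + r + 1.
  sign-pinch : ∀ {n} (k : Fin (suc (suc n))) (r : Fin (suc n)) →
    sign (punchIn k r) * sign (pinch r k) ≈ sign k * sign (suc r)
  sign-pinch zero    r    = *-comm _ _
  sign-pinch (suc k) zero =
    solve 1 (λ s → con ℤ.1ℤ :* s := (con ℤ.-1ℤ :* s) :* (con ℤ.-1ℤ :* con ℤ.1ℤ)) ≈-refl (sign k)
  sign-pinch {suc n} (suc k) (suc r) = begin
    (- 1# * x) * (- 1# * y)  ≈⟨ shuffle x y ⟩
    (- 1# * - 1#) * (x * y)  ≈⟨ *-congˡ (sign-pinch k r) ⟩
    (- 1# * - 1#) * (z * v)  ≈⟨ shuffle z v ⟨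
    (- 1# * z) * (- 1# * v)  ∎
    where
    x = sign (punchIn k r)
    y = sign (pinch r k)
    z = sign k
    v = sign (suc r)
    shuffle : ∀ x y → (- 1# * x) * (- 1# * y) ≈ (- 1# * - 1#) * (x * y)
    shuffle = solve 3 (λ e x y → (e :* x) :* (e :* y) := (e :* e) :* (x :* y)) ≈-refl (- 1#)

  det-cong : ∀ {n} {A B : Matrix n n} → (∀ i j → A i j ≈ B i j) → det A ≈ det B
  det-cong {zero}  A≈B = ≈-refl
  det-cong {suc n} {A} {B} A≈B = sum-cong-≋ {x = term A} {y = term B} (λ k →
    *-congˡ {sign k} (*-cong (A≈B zero k) (det-cong (λ i j → A≈B (suc i) (punchIn k j)))))

  -- `B` is `A` with column `k` cycled to the front. The term of column `k` becomes the leading term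
  -- of `B`; in every other term the same column is cycled to the front of a minor, which is the
  -- induction on the order.
  det-moveColumn : ∀ {n} (A B : Matrix (suc n) (suc n)) k →
    (∀ i → A i k ≈ B i zero) → (∀ i r → A i (punchIn k r) ≈ B i (suc r)) →
    det A ≈ sign k * det B
  term-moveColumn : ∀ {n} (A B : Matrix (suc n) (suc n)) k →
    (∀ i → A i k ≈ B i zero) → (∀ i r → A i (punchIn k r) ≈ B i (suc r)) →
    ∀ r → term A (punchIn k r) ≈ sign k * term B (suc r)

  det-moveColumn A B k Aₖ≈B₀ A≈B = begin
    det A
      ≈⟨ sum-remove {i = k} (term A) ⟩
    term A k + sum (λ r → term A (punchIn k r))
      ≈⟨ +-cong (*-congˡ head) (sum-cong-≋ (term-moveColumn A B k Aₖ≈B₀ A≈B)) ⟩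
    sign k * term B zero + sum (λ r → sign k * term B (suc r))
      ≈⟨ +-congˡ (*-distribˡ-sum (sign k) (λ r → term B (suc r))) ⟨
    sign k * term B zero + sign k * sum (λ r → term B (suc r))
      ≈⟨ distribˡ (sign k) (term B zero) _ ⟨
    sign k * det B ∎
    where
    head : A zero k * det (minor A k) ≈ term B zero
    head = trans (*-cong (Aₖ≈B₀ zero) (det-cong (λ i → A≈B (suc i)))) (sym (*-identityˡ _))

  term-moveColumn {suc n} A B k Aₖ≈B₀ A≈B r = begin
    sign (punchIn k r) * (A zero (punchIn k r) * det (minor A (punchIn k r)))
      ≈⟨ *-congˡ (*-cong (A≈B zero r) minors) ⟩
    sign (punchIn k r) * (B zero (suc r) * (sign (pinch r k) * det (minor B (suc r))))
      ≈⟨ solve 4 (λ s t b d → s :* (b :* (t :* d)) := (s :* t) :* (b :* d)) ≈-refl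
           (sign (punchIn k r)) (sign (pinch r k)) _ _ ⟩
    (sign (punchIn k r) * sign (pinch r k)) * (B zero (suc r) * det (minor B (suc r)))
      ≈⟨ *-congʳ (sign-pinch k r) ⟩
    (sign k * sign (suc r)) * (B zero (suc r) * det (minor B (suc r)))
      ≈⟨ *-assoc (sign k) (sign (suc r)) _ ⟩
    sign k * term B (suc r) ∎
    where
    minors : det (minor A (punchIn k r)) ≈ sign (pinch r k) * det (minor B (suc r))
    minors = det-moveColumn (minor A (punchIn k r)) (minor B (suc r)) (pinch r k)
      (λ i → trans (reflexive (cong (A (suc i)) (punchIn-pinch k r))) (Aₖ≈B₀ (suc i)))
      (λ i j → trans (reflexive (cong (A (suc i)) (punchIn-punchIn k r j))) (A≈B (suc i) (punchIn r j)))

  -- The terms of the two columns cancel: their minors differ by cycling a column past `k` others,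
  -- which accounts for all of `sign (suc k)` except one factor -1. Every other minor again has two
  -- equal columns. One of the two is column 0 because `sweep` adds multiples of that column only.
  det-equalColumns : ∀ {n} (A : Matrix (suc (suc n)) (suc (suc n))) k →
    (∀ i → A i (suc k) ≈ A i zero) → det A ≈ 0#
  term-equalColumns : ∀ {n} (A : Matrix (suc (suc n)) (suc (suc n))) k →
    (∀ i → A i (suc k) ≈ A i zero) → ∀ r → term A (suc (punchIn k r)) ≈ 0#

  det-equalColumns {n} A k Aₖ≈A₀ = begin
    term A zero + sum (λ l → term A (suc l))
      ≈⟨ +-congˡ (sum-remove {i = k} (λ l → term A (suc l))) ⟩
    term A zero + (term A (suc k) + sum (λ r → term A (suc (punchIn k r))))
      ≈⟨ +-cong (*-congˡ (*-congˡ minors)) (+-cong (*-congˡ (*-congʳ (Aₖ≈A₀ zero)))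
           (trans (sum-cong-≋ (term-equalColumns A k Aₖ≈A₀)) (sum-replicate-zero n))) ⟩
    1# * (x * (s * d)) + (- 1# * s * (x * d) + 0#)
      ≈⟨ solve 3 (λ x s d → con ℤ.1ℤ :* (x :* (s :* d)) :+ (con ℤ.-1ℤ :* s :* (x :* d) :+ con ℤ.0ℤ)
           := con ℤ.0ℤ) ≈-refl x s d ⟩
    0# ∎
    where
    x = A zero zero
    s = sign k
    d = det (minor A (suc k))
    minors : det (minor A zero) ≈ s * d
    minors = det-moveColumn (minor A zero) (minor A (suc k)) k (λ i → Aₖ≈A₀ (suc i)) (λ i r → ≈-refl)

  term-equalColumns {suc n} A k Aₖ≈A₀ r = begin
    term A (suc (punchIn k r))
      ≈⟨ *-congˡ (*-congˡ (det-equalColumns (minor A (suc (punchIn k r))) (pinch r k)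
           (λ i → trans (reflexive (cong (A (suc i) ∘ suc) (punchIn-pinch k r))) (Aₖ≈A₀ (suc i))))) ⟩
    _ * (_ * 0#)
      ≈⟨ trans (*-congˡ (zeroʳ _)) (zeroʳ _) ⟩
    0# ∎

  -- Additivity and homogeneity in the combined form in which a changed sweep coefficient enters. In
  -- the term of column `j` the combination stands in the first row entry and possibly nowhere else;
  -- in any other term it sits inside the minor, at column `pinch r j`.
  det-linearColumn : ∀ {n} (A B C : Matrix n n) a j →
    (∀ i → C i j ≈ A i j + a * B i j) →
    (∀ i k → k ≢ j → C i k ≈ A i k) → (∀ i k → k ≢ j → C i k ≈ B i k) →
    det C ≈ det A + a * det B
  det-linearColumn {suc n} A B C a j Cⱼ C≈A C≈B = begin
    det C
      ≈⟨ sum-remove {i = j} (term C) ⟩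
    term C j + sum (λ r → term C (punchIn j r))
      ≈⟨ +-cong head (trans (sum-cong-≋ (tail j Cⱼ C≈A C≈B))
           (∑-distrib-+ (λ r → term A (punchIn j r)) (λ r → a * term B (punchIn j r)))) ⟩
    (term A j + a * term B j) + (As + sum (λ r → a * term B (punchIn j r)))
      ≈⟨ +-congˡ (+-congˡ (*-distribˡ-sum a (λ r → term B (punchIn j r)))) ⟨
    (term A j + a * term B j) + (As + a * Bs)
      ≈⟨ solve 5 (λ x y a u v → (x :+ a :* y) :+ (u :+ a :* v) := (x :+ u) :+ a :* (y :+ v)) ≈-refl
           (term A j) (term B j) a As Bs ⟩
    (term A j + As) + a * (term B j + Bs)
      ≈⟨ +-cong (sum-remove {i = j} (term A)) (*-congˡ (sum-remove {i = j} (term B))) ⟨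
    det A + a * det B ∎
    where
    As = sum (λ r → term A (punchIn j r))
    Bs = sum (λ r → term B (punchIn j r))
    head : term C j ≈ term A j + a * term B j
    head = begin
      sign j * (C zero j * det (minor C j))
        ≈⟨ *-congˡ (*-congʳ (Cⱼ zero)) ⟩
      sign j * ((A zero j + a * B zero j) * det (minor C j))
        ≈⟨ solve 5 (λ s x a y d → s :* ((x :+ a :* y) :* d) := s :* (x :* d) :+ a :* (s :* (y :* d))) ≈-refl
             (sign j) (A zero j) a (B zero j) _ ⟩
      sign j * (A zero j * det (minor C j)) + a * (sign j * (B zero j * det (minor C j)))
        ≈⟨ +-cong (*-congˡ (*-congˡ (det-cong (λ i r → C≈A (suc i) (punchIn j r) (Fin.punchInᵢ≢i j r)))))
                  (*-congˡ (*-congˡ (*-congˡ (det-cong (λ i r → C≈B (suc i) (punchIn j r) (Fin.punchInᵢ≢i j r)))))) ⟩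
      term A j + a * term B j ∎
    -- Quantified over its own order, so that matching on it can expose a column of the minor: a
    -- column other than `j` exists only from order two on.
    tail : ∀ {n} {A B C : Matrix (suc n) (suc n)} j →
      (∀ i → C i j ≈ A i j + a * B i j) →
      (∀ i k → k ≢ j → C i k ≈ A i k) → (∀ i k → k ≢ j → C i k ≈ B i k) →
      ∀ r → term C (punchIn j r) ≈ term A (punchIn j r) + a * term B (punchIn j r)
    tail {suc n} {A} {B} {C} j Cⱼ C≈A C≈B r = begin
      s * (C zero l * det (minor C l))
        ≈⟨ *-congˡ (*-congˡ (det-linearColumn (minor A l) (minor B l) (minor C l) a j′
             (λ i → subst (λ x → C (suc i) x ≈ A (suc i) x + a * B (suc i) x) (≡-sym (punchIn-pinch j r)) (Cⱼ (suc i)))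
             (λ i k k≢j′ → C≈A (suc i) (punchIn l k) (away k k≢j′))
             (λ i k k≢j′ → C≈B (suc i) (punchIn l k) (away k k≢j′)))) ⟩
      s * (C zero l * (dA + a * dB))
        ≈⟨ solve 5 (λ s x a y d → s :* (x :* (y :+ a :* d)) := s :* (x :* y) :+ a :* (s :* (x :* d))) ≈-refl
             s (C zero l) a dA dB ⟩
      s * (C zero l * dA) + a * (s * (C zero l * dB))
        ≈⟨ +-cong (*-congˡ (*-congʳ (C≈A zero l (Fin.punchInᵢ≢i j r))))
             (*-congˡ (*-congˡ (*-congʳ (C≈B zero l (Fin.punchInᵢ≢i j r))))) ⟩
      term A l + a * term B l ∎
      where
      l = punchIn j r
      j′ = pinch r j
      s = sign l
      dA = det (minor A l)
      dB = det (minor B l)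
      away : ∀ k → k ≢ j′ → punchIn l k ≢ j
      away k k≢j′ eq = k≢j′ (Fin.punchIn-injective l k j′ (≡-trans eq (≡-sym (punchIn-pinch j r))))

  -- The coordinates are exchanged one at a time; `f-cong` takes the place of function
  -- extensionality.
  constant-coordinatewise : ∀ {n} (f : (Fin n → Carrier) → Carrier) →
    (∀ {a b} → (∀ k → a k ≈ b k) → f a ≈ f b) →
    (∀ a k x → f (updateAt a k (λ _ → x)) ≈ f a) → ∀ a b → f a ≈ f b
  constant-coordinatewise {zero}  f f-cong f-step a b = f-cong (λ ())
  constant-coordinatewise {suc n} f f-cong f-step a b = begin
    f a
      ≈⟨ f-step a zero (b zero) ⟨
    f (updateAt a zero (λ _ → b zero))
      ≈⟨ f-cong (λ { zero → ≈-refl ; (suc k) → ≈-refl }) ⟩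
    f (b zero ∷ᵥ (a ∘ suc))
      ≈⟨ constant-coordinatewise (λ t → f (b zero ∷ᵥ t))
           (λ t≈u → f-cong (λ { zero → ≈-refl ; (suc k) → t≈u k }))
           (λ t k x → trans (f-cong (λ { zero → ≈-refl ; (suc l) → ≈-refl })) (f-step (b zero ∷ᵥ t) (suc k) x))
           (a ∘ suc) (b ∘ suc) ⟩
    f (b zero ∷ᵥ (b ∘ suc))
      ≈⟨ f-cong (λ { zero → ≈-refl ; (suc k) → ≈-refl }) ⟩
    f b ∎

  sweep : ∀ {n} → Matrix (suc n) (suc n) → (Fin n → Carrier) → Matrix (suc n) (suc n)
  sweep A a i zero    = A i zero
  sweep A a i (suc k) = A i (suc k) + a k * A i zero

  -- The coefficients are moved to 0 one by one. Changing one of them alters the determinant by a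
  -- multiple of the determinant of `B`, in which column 0 occurs twice.
  det-sweep : ∀ {n} (A : Matrix (suc n) (suc n)) a → det (sweep A a) ≈ det A
  det-sweep A a = trans
    (constant-coordinatewise (λ a → det (sweep A a))
      (λ {a} {b} a≈b → det-cong {A = sweep A a} {B = sweep A b}
        (λ { i zero → ≈-refl ; i (suc k) → +-congˡ (*-congʳ (a≈b k)) }))
      (step A) a (λ _ → 0#))
    (det-cong {A = sweep A (λ _ → 0#)} {B = A}
      (λ { i zero → ≈-refl ; i (suc k) → trans (+-congˡ (zeroˡ _)) (+-identityʳ _) }))
    where
    step : ∀ {n} (A : Matrix (suc n) (suc n)) a k x →
      det (sweep A (updateAt a k (λ _ → x))) ≈ det (sweep A a)
    step {suc n} A a k x = begin
      det C                                ≈⟨ det-linearColumn (sweep A a) B C (x - a k) (suc k) column other other′ ⟩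
      det (sweep A a) + (x - a k) * det B  ≈⟨ +-congˡ (*-congˡ (det-equalColumns B k
                                                (λ i → reflexive (updateAt-updates (suc k) (sweep A a i))))) ⟩
      det (sweep A a) + (x - a k) * 0#     ≈⟨ trans (+-congˡ (zeroʳ _)) (+-identityʳ _) ⟩
      det (sweep A a)                      ∎
      where
      B C : Matrix (suc (suc n)) (suc (suc n))
      B i = updateAt (sweep A a i) (suc k) (λ _ → A i zero)
      C = sweep A (updateAt a k (λ _ → x))
      column : ∀ i → C i (suc k) ≈ sweep A a i (suc k) + (x - a k) * B i (suc k)
      column i = begin
        A i (suc k) + updateAt a k (λ _ → x) k * A i zero
          ≡⟨ cong (λ y → A i (suc k) + y * A i zero) (updateAt-updates k a) ⟩
        A i (suc k) + x * A i zero
          ≈⟨ solve 4 (λ u x v y → u :+ x :* v := (u :+ y :* v) :+ (x :- y) :* v) ≈-refl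
               (A i (suc k)) x (A i zero) (a k) ⟩
        sweep A a i (suc k) + (x - a k) * A i zero
          ≡⟨ cong (λ y → sweep A a i (suc k) + (x - a k) * y) (updateAt-updates (suc k) (sweep A a i)) ⟨
        sweep A a i (suc k) + (x - a k) * B i (suc k) ∎
      other : ∀ i l → l ≢ suc k → C i l ≈ sweep A a i l
      other i zero    _   = ≈-refl
      other i (suc l) l≢k = reflexive (cong (λ y → A i (suc l) + y * A i zero)
        (updateAt-minimal l k a (l≢k ∘ cong suc)))
      other′ : ∀ i l → l ≢ suc k → C i l ≈ B i l
      other′ i l l≢k = trans (other i l l≢k)
        (reflexive (≡-sym (updateAt-minimal l (suc k) (sweep A a i) l≢k)))

  schur : ∀ {n} → Matrix (suc n) (suc n) → Matrix n n
  schur A i k = A (suc i) (suc k) - A (suc i) zero * A zero (suc k)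

  -- Sweeping with the negated first row clears that row outside the pivot. Expansion along it then
  -- leaves one term, whose minor is the Schur complement.
  det-schur : ∀ {n} (A : Matrix (suc n) (suc n)) → A zero zero ≈ 1# → det A ≈ det (schur A)
  det-schur {n} A A₀₀≈1 = begin
    det A
      ≈⟨ det-sweep A a ⟨
    term (sweep A a) zero + sum (λ k → term (sweep A a) (suc k))
      ≈⟨ +-cong (*-congˡ (*-cong A₀₀≈1 (det-cong corner))) (trans (sum-cong-≋ vanish) (sum-replicate-zero n)) ⟩
    1# * (1# * det (schur A)) + 0#
      ≈⟨ trans (+-identityʳ _) (trans (*-identityˡ _) (*-identityˡ _)) ⟩
    det (schur A) ∎
    where
    a : Fin n → Carrier
    a k = - A zero (suc k)
    corner : ∀ i k → sweep A a (suc i) (suc k) ≈ schur A i k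
    corner i k = solve 3 (λ u v x → u :+ (:- v) :* x := u :- x :* v) ≈-refl
      (A (suc i) (suc k)) (A zero (suc k)) (A (suc i) zero)
    row : ∀ k → sweep A a zero (suc k) ≈ 0#
    row k = begin
      A zero (suc k) + - A zero (suc k) * A zero zero  ≈⟨ +-congˡ (*-congˡ A₀₀≈1) ⟩
      A zero (suc k) + - A zero (suc k) * 1#           ≈⟨ +-congˡ (*-identityʳ _) ⟩
      A zero (suc k) - A zero (suc k)                  ≈⟨ -‿inverseʳ _ ⟩
      0#                                               ∎
    vanish : ∀ k → term (sweep A a) (suc k) ≈ 0#
    vanish k = trans
      (*-congˡ {sign (suc k)} (trans (*-congʳ {det (minor (sweep A a) (suc k))} (row k)) (zeroˡ _))) (zeroʳ _)

-- P-matrices and pivots equal to 1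

module PMatrix {c ℓ₁ ℓ₂} (F : OrderedField c ℓ₁ ℓ₂) where

  open RingProperties F
  open OrderProperties F
  open OrderedField F using (0<1)
  open Over F
  open Determinant F

  Increasing : ∀ {k n} → (Fin k → Fin n) → Set
  Increasing α = ∀ {i j} → i Fin.< j → α i Fin.< α j

  data View {n} : ∀ {k} → (Fin k → Fin (suc n)) → Set where
    empty : {α : Fin 0 → Fin (suc n)} → View α
    shifted : ∀ {k} {α : Fin k → Fin (suc n)} (β : Fin k → Fin n) → Increasing β →
      (∀ i → α i ≡ suc (β i)) → View α
    pivoted : ∀ {k} {α : Fin (suc k) → Fin (suc n)} (β : Fin k → Fin n) → Increasing β →
      α zero ≡ zero → (∀ i → α (suc i) ≡ suc (β i)) → View α

  predecessor : ∀ {n} (x : Fin (suc n)) → 0 ℕ.< toℕ x → Σ[ y ∈ Fin n ] x ≡ suc y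
  predecessor (suc y) _ = y , refl

  shift : ∀ {k n} (α : Fin k → Fin (suc n)) → Increasing α → (∀ i → 0 ℕ.< toℕ (α i)) →
    Σ[ β ∈ (Fin k → Fin n) ] Increasing β × (∀ i → α i ≡ suc (β i))
  shift α α↑ α>0 = (λ i → proj₁ (predecessor (α i) (α>0 i))) ,
    (λ {i} {j} i<j → ℕ.s<s⁻¹ (subst₂ Fin._<_
      (proj₂ (predecessor (α i) (α>0 i))) (proj₂ (predecessor (α j) (α>0 j))) (α↑ i<j))) ,
    (λ i → proj₂ (predecessor (α i) (α>0 i)))

  view : ∀ {k n} (α : Fin k → Fin (suc n)) → Increasing α → View α
  view {zero}  α α↑ = empty
  view {suc k} α α↑ with α zero in eq
  ... | zero with shift (α ∘ suc) (λ i<j → α↑ (s≤s i<j)) (λ i → ℕ.≤-<-trans z≤n (α↑ {zero} {suc i} (s≤s z≤n)))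
  ...   | β , β↑ , α≡β = pivoted β β↑ eq α≡β
  view {suc k} α α↑ | suc x with shift α α↑ positive
    where
    positive : ∀ i → 0 ℕ.< toℕ (α i)
    positive zero    = subst (λ y → 0 ℕ.< toℕ y) (≡-sym eq) (s≤s z≤n)
    positive (suc i) = ℕ.≤-<-trans z≤n (α↑ {zero} {suc i} (s≤s z≤n))
  ... | β , β↑ , α≡β = shifted β β↑ α≡β

  isPMatrix-cong : ∀ {n} {A B : Matrix n n} → (∀ i j → A i j ≈ B i j) → IsPMatrix A → IsPMatrix B
  isPMatrix-cong A≈B P α α↑ = <-respʳ-≈ (det-cong (λ i j → A≈B (α i) (α j))) (P α α↑)

  -- Principal minors that avoid index 0 belong to the matrix with row and column 0 deleted. For an
  -- index set containing 0, restriction commutes with forming the Schur complement, so by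
  -- `det-schur` the minor is a principal minor of `schur A`.
  isPMatrix-pivot : ∀ {n} (A : Matrix (suc n) (suc n)) → A zero zero ≈ 1# →
    IsPMatrix (λ i j → A (suc i) (suc j)) → IsPMatrix (schur A) → IsPMatrix A
  isPMatrix-pivot A A₀₀≈1 P S α α↑ with view α α↑
  ... | empty = 0<1
  ... | shifted β β↑ α≡β = <-respʳ-≈
    (det-cong (λ i j → reflexive (≡-sym (cong₂ A (α≡β i) (α≡β j))))) (P β β↑)
  ... | pivoted β β↑ α₀≡0 α≡β = <-respʳ-≈ (sym (begin
    det (λ i j → A (α i) (α j))
      ≈⟨ det-schur (λ i j → A (α i) (α j)) (trans (reflexive (cong₂ A α₀≡0 α₀≡0)) A₀₀≈1) ⟩
    det (schur (λ i j → A (α i) (α j)))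
      ≈⟨ det-cong (λ i j → +-cong (reflexive (cong₂ A (α≡β i) (α≡β j)))
           (-‿cong (*-cong (reflexive (cong₂ A (α≡β i) α₀≡0)) (reflexive (cong₂ A α₀≡0 (α≡β j)))))) ⟩
    det (λ i j → schur A (β i) (β j)) ∎)) (S β β↑)
    where open SetoidReasoning setoid

-- Finite sums and running minima

module Sums {c ℓ₁ ℓ₂} (F : OrderedField c ℓ₁ ℓ₂) where
  open RingProperties F
  open OrderProperties F
  open OrderedField F using (_≤_)
  open SetoidReasoning setoid

  sum-neg : ∀ {n} (f : Fin n → Carrier) → sum (λ i → - f i) ≈ - sum f
  sum-neg {zero}  f = sym -0#≈0#
  sum-neg {suc n} f = trans (+-congˡ (sum-neg (f ∘ suc))) (-‿+-comm _ _)

  sum-zero : ∀ {n} {f : Fin n → Carrier} → (∀ i → f i ≈ 0#) → sum f ≈ 0#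
  sum-zero {n} f≈0 = trans (sum-cong-≋ f≈0) (sum-replicate-zero n)

  sum-nonnegative : ∀ {n} (f : Fin n → Carrier) → (∀ i → 0# ≤ f i) → 0# ≤ sum f
  sum-nonnegative {zero}  f f≥0 = inj₂ ≈-refl
  sum-nonnegative {suc n} f f≥0 = +-nonnegative (f≥0 zero) (sum-nonnegative (f ∘ suc) (f≥0 ∘ suc))

  sum-split : ∀ m {n} (f : Fin (m ℕ.+ n) → Carrier) →
    sum f ≈ sum (λ i → f (i ↑ˡ n)) + sum (λ j → f (m ↑ʳ j))
  sum-split zero    f = sym (+-identityˡ _)
  sum-split (suc m) f = trans (+-congˡ (sum-split m (f ∘ suc))) (sym (+-assoc _ _ _))

-- Running minima.  Item p belongs to track J p and has value v p, and each
-- track carries a current value, u₀ at the start and u at the end.  Item p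
-- lowers the value x of its track by s p = max (x - v p) 0, leaving τ p =
-- max (v p - x) 0; as s p τ p = 0, this is a complementarity problem.
module Minima {c ℓ₁ ℓ₂} (F : OrderedField c ℓ₁ ℓ₂) {n : ℕ} where
  open RingProperties F
  open OrderProperties F
  open OrderedField F using (_≤_; compare)
  open Sums F
  open SetoidReasoning setoid

  hit : Fin n → Fin n → Carrier
  hit i j = if does (i Fin.≟ j) then 1# else 0#

  hit-refl : ∀ i → hit i i ≈ 1#
  hit-refl i with i Fin.≟ i
  ... | yes _  = ≈-refl
  ... | no i≢i = contradiction refl i≢i

  hit-≢ : ∀ {i j} → i ≢ j → hit i j ≈ 0#
  hit-≢ {i} {j} i≢j with i Fin.≟ j
  ... | yes i≡j = contradiction i≡j i≢j
  ... | no _    = ≈-refl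

  -- Entry 1 means that `r` is at or before `p` in the same track: the decrease made at `r` counts
  -- in the slack of `p`, its own decrease included. Peeling off item 0 suits induction over the
  -- items; `lower-<`, `lower-≢` and `lower-≡` recover the closed form that the program tests.
  lower : ∀ {m} → (Fin m → Fin n) → Fin m → Fin m → Carrier
  lower J zero    zero    = 1#
  lower J zero    (suc r) = 0#
  lower J (suc p) zero    = hit (J zero) (J (suc p))
  lower J (suc p) (suc r) = lower (J ∘ suc) p r

  lower-< : ∀ {m} (J : Fin m → Fin n) {p r} → toℕ p ℕ.< toℕ r → lower J p r ≈ 0#
  lower-< J {zero}  {suc r} p<r = ≈-refl
  lower-< J {suc p} {suc r} p<r = lower-< (J ∘ suc) (ℕ.s<s⁻¹ p<r)

  lower-≢ : ∀ {m} (J : Fin m → Fin n) {p r} → J p ≢ J r → lower J p r ≈ 0#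
  lower-≢ J {zero}  {zero}  ≢ = contradiction refl ≢
  lower-≢ J {zero}  {suc r} ≢ = ≈-refl
  lower-≢ J {suc p} {zero}  ≢ = hit-≢ (≢ ∘ ≡-sym)
  lower-≢ J {suc p} {suc r} ≢ = lower-≢ (J ∘ suc) ≢

  lower-≡ : ∀ {m} (J : Fin m → Fin n) {p r} → toℕ r ℕ.≤ toℕ p → J p ≡ J r → lower J p r ≈ 1#
  lower-≡ J {zero}  {zero}  r≤p ≡ = ≈-refl
  lower-≡ J {suc p} {zero}  r≤p ≡ = trans (reflexive (cong (hit (J zero)) ≡)) (hit-refl (J zero))
  lower-≡ J {suc p} {suc r} r≤p ≡ = lower-≡ (J ∘ suc) (ℕ.s≤s⁻¹ r≤p) ≡

  -- The recursion x ↦ x - s unrolled into equations linear in `v`, `u₀` and `s`, as the rows of an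
  -- LCP must be. `Descends-tail` and `Descends-cons` convert back to one item at a time.
  record Descends {m} (J : Fin m → Fin n) (v : Fin m → Carrier) (u₀ : Fin n → Carrier)
      (s τ : Fin m → Carrier) (u : Fin n → Carrier) : Set ℓ₁ where
    field
      slack : ∀ p → τ p ≈ v p - u₀ (J p) + sum (λ r → lower J p r * s r)
      final : ∀ j → u j ≈ u₀ j - sum (λ r → hit (J r) j * s r)

  record Complementary {m} (s τ : Fin m → Carrier) : Set (ℓ₁ Level.⊔ ℓ₂) where
    field
      s≥0  : ∀ p → 0# ≤ s p
      τ≥0  : ∀ p → 0# ≤ τ p
      sτ≈0 : ∀ p → s p * τ p ≈ 0#

  next : (Fin n → Carrier) → Fin n → Carrier → Fin n → Carrier
  next u₀ i x j = u₀ j - hit i j * x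

  Descends-tail : ∀ {m} {J : Fin (suc m) → Fin n} {v u₀ s τ u} → Descends J v u₀ s τ u →
    Descends (J ∘ suc) (v ∘ suc) (next u₀ (J zero) (s zero)) (s ∘ suc) (τ ∘ suc) u
  Descends-tail {J = J} {v} {u₀} {s} D = record
    { slack = λ p → trans (slack (suc p))
        (solve 5 (λ a b h x y → a :- b :+ (h :* x :+ y) := a :- (b :- h :* x) :+ y) ≈-refl
          (v (suc p)) (u₀ (J (suc p))) (hit (J zero) (J (suc p))) (s zero) _)
    ; final = λ j → trans (final j)
        (solve 4 (λ b h x y → b :- (h :* x :+ y) := b :- h :* x :- y) ≈-refl
          (u₀ j) (hit (J zero) j) (s zero) _)
    }
    where open Descends D

  Descends-cons : ∀ {m} {J : Fin (suc m) → Fin n} {v u₀ s τ u} →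
    τ zero ≈ v zero - u₀ (J zero) + s zero →
    Descends (J ∘ suc) (v ∘ suc) (next u₀ (J zero) (s zero)) (s ∘ suc) (τ ∘ suc) u →
    Descends J v u₀ s τ u
  Descends-cons {J = J} {v} {u₀} {s} {τ} {u} first D = record { slack = slack′ ; final = final′ }
    where
    open Descends D
    slack′ : ∀ p → τ p ≈ v p - u₀ (J p) + sum (λ r → lower J p r * s r)
    slack′ zero = trans first (+-congˡ (sym (trans
      (+-cong (*-identityˡ _) (sum-zero (λ r → zeroˡ (s (suc r))))) (+-identityʳ _))))
    slack′ (suc p) = trans (slack p)
      (solve 5 (λ a b h x y → a :- (b :- h :* x) :+ y := a :- b :+ (h :* x :+ y)) ≈-refl
          (v (suc p)) (u₀ (J (suc p))) (hit (J zero) (J (suc p))) (s zero) _)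
    final′ : ∀ j → u j ≈ u₀ j - sum (λ r → hit (J r) j * s r)
    final′ j = trans (final j)
        (solve 4 (λ b h x y → b :- h :* x :- y := b :- (h :* x :+ y)) ≈-refl
          (u₀ j) (hit (J zero) j) (s zero) _)

  Complementary-tail : ∀ {m} {s τ : Fin (suc m) → Carrier} → Complementary s τ →
    Complementary (s ∘ suc) (τ ∘ suc)
  Complementary-tail C = record { s≥0 = s≥0 ∘ suc ; τ≥0 = τ≥0 ∘ suc ; sτ≈0 = sτ≈0 ∘ suc }
    where open Complementary C

  hit*-nonnegative : ∀ i j {x} → 0# ≤ x → 0# ≤ hit i j * x
  hit*-nonnegative i j x≥0 with i Fin.≟ j
  ... | yes _ = ≤-respʳ-≈ (sym (*-identityˡ _)) x≥0
  ... | no _  = inj₂ (sym (zeroˡ _))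

  -- The excess `d` is the slack left at `p` plus all later decreases in its track. Having it
  -- explicit serves both directions: with u ≥ 0 it makes `v p` nonnegative, and if moreover `v p`
  -- is 0 it forces the final value to be 0.
  final-below : ∀ {m} {J : Fin m → Fin n} {v u₀ s τ u} →
    Descends J v u₀ s τ u → Complementary s τ →
    ∀ p → ∃ λ d → 0# ≤ d × v p ≈ u (J p) + d
  final-below {J = J} {v} {u₀} {s} {τ} {u} D C zero = τ zero + y ,
    +-nonnegative (τ≥0 zero) (sum-nonnegative _ (λ r → hit*-nonnegative (J (suc r)) (J zero) (s≥0 (suc r)))) ,
    (begin
      v zero
        ≈⟨ solve 4 (λ v b x y → v := b :- (con ℤ.1ℤ :* x :+ y) :+ (v :- b :+ (con ℤ.1ℤ :* x :+ con ℤ.0ℤ) :+ y))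
             ≈-refl (v zero) (u₀ (J zero)) (s zero) y ⟩
      u₀ (J zero) - (1# * s zero + y) + (v zero - u₀ (J zero) + (1# * s zero + 0#) + y)
        ≈⟨ +-cong (trans (final (J zero)) (+-congˡ (-‿cong (+-congʳ (*-congʳ (hit-refl (J zero)))))))
             (+-congʳ (trans (slack zero) (+-congˡ (+-congˡ (sum-zero (λ r → zeroˡ (s (suc r)))))))) ⟨
      u (J zero) + (τ zero + y) ∎)
    where
    open Descends D
    open Complementary C
    y = sum (λ r → hit (J (suc r)) (J zero) * s (suc r))
  final-below D C (suc p) = final-below (Descends-tail D) (Complementary-tail C) p

  -- At each item of the track either s = 0 and the value persists, or τ = 0 and the value becomes
  -- that of the item. When `u₀` comes from starting rows, both alternatives name a row of the
  -- block.
  final-attained : ∀ {m} {J : Fin m → Fin n} {v u₀ s τ u} →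
    Descends J v u₀ s τ u → Complementary s τ →
    ∀ j → u j ≈ u₀ j ⊎ ∃ λ p → J p ≡ j × u j ≈ v p
  final-attained {zero} {u₀ = u₀} D C j = inj₁ (trans (Descends.final D j) (x-y≈x ≈-refl))
  final-attained {suc m} {J} {v} {u₀} {s} {τ} {u} D C j
    with final-attained (Descends-tail D) (Complementary-tail C) j
  ... | inj₂ (p , Jp≡j , uⱼ≈v) = inj₂ (suc p , Jp≡j , uⱼ≈v)
  ... | inj₁ uⱼ≈ with J zero Fin.≟ j
  ...   | no _ = inj₁ (trans uⱼ≈ (x-y≈x (zeroˡ _)))
  ...   | yes refl with *-integral (Complementary.sτ≈0 C zero)
  ...     | inj₁ s≈0 = inj₁ (trans uⱼ≈ (x-y≈x (trans (*-identityˡ _) s≈0)))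
  ...     | inj₂ τ≈0 = inj₂ (zero , refl , (begin
    u j
      ≈⟨ uⱼ≈ ⟩
    u₀ j - 1# * s zero
      ≈⟨ solve 3 (λ b x v → b :- con ℤ.1ℤ :* x := v :- (v :- b :+ (con ℤ.1ℤ :* x :+ con ℤ.0ℤ)))
           ≈-refl (u₀ j) (s zero) (v zero) ⟩
    v zero - (v zero - u₀ j + (1# * s zero + 0#))
      ≈⟨ +-congˡ (-‿cong (trans (Descends.slack D zero) (+-congˡ (+-congˡ (sum-zero (λ r → zeroˡ (s (suc r)))))))) ⟨
    v zero - τ zero
      ≈⟨ x-y≈x τ≈0 ⟩
    v zero ∎))

  record Step (x y : Carrier) : Set (c Level.⊔ ℓ₁ Level.⊔ ℓ₂) where
    field
      {s τ}    : Carrier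
      s≥0      : 0# ≤ s
      τ≥0      : 0# ≤ τ
      sτ≈0     : s * τ ≈ 0#
      τ≈y-x+s  : τ ≈ y - x + s
      x-s≥0    : 0# ≤ x - s

  step : ∀ {x y} → 0# ≤ x → 0# ≤ y → Step x y
  step {x} {y} x≥0 y≥0 with compare x y
  ... | tri< x<y _ _ = record
    { s≥0 = inj₂ ≈-refl ; τ≥0 = inj₁ (x<y⇒0<y-x x<y) ; sτ≈0 = zeroˡ _
    ; τ≈y-x+s = sym (+-identityʳ _) ; x-s≥0 = ≤-respʳ-≈ (sym (x-y≈x ≈-refl)) x≥0 }
  ... | tri≈ _ x≈y _ = record
    { s = 0# ; τ = 0# ; s≥0 = inj₂ ≈-refl ; τ≥0 = inj₂ ≈-refl ; sτ≈0 = zeroˡ _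
    ; τ≈y-x+s = sym (trans (+-identityʳ _) (trans (+-congˡ (-‿cong x≈y)) (-‿inverseʳ y)))
    ; x-s≥0 = ≤-respʳ-≈ (sym (x-y≈x ≈-refl)) x≥0 }
  ... | tri> _ _ y<x = record
    { s≥0 = inj₁ (x<y⇒0<y-x y<x) ; τ≥0 = inj₂ ≈-refl ; sτ≈0 = zeroʳ _
    ; τ≈y-x+s = solve 2 (λ x y → con ℤ.0ℤ := y :- x :+ (x :- y)) ≈-refl x y
    ; x-s≥0 = ≤-respʳ-≈ (solve 2 (λ x y → y := x :- (x :- y)) ≈-refl x y) y≥0 }

  record Minimized {m} (J : Fin m → Fin n) (v : Fin m → Carrier) (u₀ : Fin n → Carrier)
      : Set (c Level.⊔ ℓ₁ Level.⊔ ℓ₂) where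
    field
      {s τ}         : Fin m → Carrier
      {u}           : Fin n → Carrier
      u≥0           : ∀ j → 0# ≤ u j
      descends      : Descends J v u₀ s τ u
      complementary : Complementary s τ

  -- Supplies the auxiliary part of an LCP solution. Existence is enough, since the result is
  -- compared with the given unique solution.
  minimize : ∀ {m} (J : Fin m → Fin n) v u₀ → (∀ p → 0# ≤ v p) → (∀ j → 0# ≤ u₀ j) →
    Minimized J v u₀
  minimize {zero} J v u₀ v≥0 u₀≥0 = record
    { s = λ () ; τ = λ () ; u = u₀ ; u≥0 = u₀≥0
    ; descends = record { slack = λ () ; final = λ j → sym (x-y≈x ≈-refl) }
    ; complementary = record { s≥0 = λ () ; τ≥0 = λ () ; sτ≈0 = λ () }
    }
  minimize {suc m} J v u₀ v≥0 u₀≥0 = record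
    { s = s ; τ = τ ; u≥0 = Rest.u≥0
    ; descends = Descends-cons Head.τ≈y-x+s Rest.descends
    ; complementary = record
      { s≥0  = λ { zero → Head.s≥0 ; (suc p) → Tail.s≥0 p }
      ; τ≥0  = λ { zero → Head.τ≥0 ; (suc p) → Tail.τ≥0 p }
      ; sτ≈0 = λ { zero → Head.sτ≈0 ; (suc p) → Tail.sτ≈0 p }
      }
    }
    where
    module Head = Step (step (u₀≥0 (J zero)) (v≥0 zero))
    next≥0 : ∀ j → 0# ≤ next u₀ (J zero) Head.s j
    next≥0 j with J zero Fin.≟ j
    ... | yes refl = ≤-respʳ-≈ (+-congˡ (-‿cong (sym (*-identityˡ _)))) Head.x-s≥0
    ... | no _     = ≤-respʳ-≈ (sym (x-y≈x (zeroˡ _))) (u₀≥0 j)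
    module Rest = Minimized (minimize (J ∘ suc) (v ∘ suc) (next u₀ (J zero) Head.s) (v≥0 ∘ suc) next≥0)
    module Tail = Complementary Rest.complementary
    s τ : Fin (suc m) → Carrier
    s zero    = Head.s
    s (suc p) = Rest.s p
    τ zero    = Head.τ
    τ (suc p) = Rest.τ p

-- The expanded LCP: P-property and correspondence of solutions

module Reduction {c ℓ₁ ℓ₂} (F : OrderedField c ℓ₁ ℓ₂) {n : ℕ} {b : Fin n → ℕ} (M : Over.BlockMatrix F b) where
  open RingProperties F
  open OrderProperties F
  open OrderedField F using (_≤_)
  open Over F
  open Determinant F using (schur)
  open PMatrix F
  open Sums F
  open Minima F {n}
  open import Algebra.Definitions.RawSemiring (Semiring.rawSemiring semiring) using (product)
  open SetoidReasoning setoid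

  Row : Set
  Row = Σ[ j ∈ Fin n ] Fin (b j)

  block : ∀ {m} → (Fin m → Row) → Fin m → Fin n
  block t = proj₁ ∘ t

  module _ (ρ : ∀ j → Fin (b j)) {m : ℕ} (t : Fin m → Row) where

    entry : Fin m ⊎ Fin n → Fin m ⊎ Fin n → Carrier
    entry (inj₁ p) (inj₁ r) = lower (block t) p r
    entry (inj₁ p) (inj₂ k) = M (proj₁ (t p)) (proj₂ (t p)) k - M (block t p) (ρ (block t p)) k
    entry (inj₂ j) (inj₁ r) = - hit (block t r) j
    entry (inj₂ j) (inj₂ k) = M j (ρ j) k

    expanded : Matrix (m ℕ.+ n) (m ℕ.+ n)
    expanded i k = entry (splitAt m i) (splitAt m k)

  entry-suc : ∀ ρ {m} (t : Fin (suc m) → Row) x y →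
    entry ρ (t ∘ suc) x y ≡ entry ρ t (Sum.map suc id x) (Sum.map suc id y)
  entry-suc ρ t (inj₁ p) (inj₁ r) = refl
  entry-suc ρ t (inj₁ p) (inj₂ k) = refl
  entry-suc ρ t (inj₂ j) (inj₁ r) = refl
  entry-suc ρ t (inj₂ j) (inj₂ k) = refl

  setRow : Row → (∀ j → Fin (b j)) → ∀ j → Fin (b j)
  setRow (i , x) ρ j with i Fin.≟ j
  ... | yes refl = x
  ... | no _     = ρ j

  -- The pivot row vanishes on the other auxiliary columns, so these stay as they are. Write T for
  -- row `t zero` and B for the starting row of its block. In that block, row R yields (R - B) - (T
  -- - B) = R - T, and the starting row yields B + (T - B) = T. In all other blocks the pivot column
  -- is 0.
  entry-schur : ∀ ρ {m} (t : Fin (suc m) → Row) x y →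
    entry (setRow (t zero) ρ) (t ∘ suc) x y ≈
      entry ρ t (Sum.map suc id x) (Sum.map suc id y)
      - entry ρ t (Sum.map suc id x) (inj₁ zero) * entry ρ t (inj₁ zero) (Sum.map suc id y)
  entry-schur ρ t (inj₁ p) (inj₁ r) = solve 2 (λ x y → x := x :- y :* con ℤ.0ℤ) ≈-refl _ _
  entry-schur ρ t (inj₁ p) (inj₂ k) with t zero | t (suc p)
  ... | i , x | j , y with i Fin.≟ j
  ...   | yes refl = solve 3 (λ x y z → x :- y := x :- z :- con ℤ.1ℤ :* (y :- z)) ≈-refl _ _ _
  ...   | no _     = solve 2 (λ x y → x := x :- con ℤ.0ℤ :* y) ≈-refl _ _
  entry-schur ρ t (inj₂ j) (inj₁ r) = solve 2 (λ x y → x := x :- y :* con ℤ.0ℤ) ≈-refl _ _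
  entry-schur ρ t (inj₂ j) (inj₂ k) with t zero
  ... | i , x with i Fin.≟ j
  ...   | yes refl = solve 2 (λ x y → x := y :- (:- con ℤ.1ℤ) :* (x :- y)) ≈-refl _ _
  ...   | no _     = solve 2 (λ x y → x := x :- (:- con ℤ.0ℤ) :* y) ≈-refl _ _

  -- Deleting the first auxiliary variable leaves a matrix of the same family, and
  -- so does pivoting on it: the Schur complement moves ρ to the row t zero.
  expanded-isPMatrix : IsBlockPMatrix M → ∀ ρ {m} (t : Fin m → Row) → IsPMatrix (expanded ρ t)
  -- With no auxiliary variable left the matrix is the representative submatrix chosen by `ρ`; only
  -- here is the P-property of `M` used.
  expanded-isPMatrix P ρ {zero}  t = P ρ
  expanded-isPMatrix P ρ {suc m} t = isPMatrix-pivot (expanded ρ t) ≈-refl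
    (isPMatrix-cong (λ i j → reflexive (entry-suc ρ t (splitAt m i) (splitAt m j)))
      (expanded-isPMatrix P ρ (t ∘ suc)))
    (isPMatrix-cong (λ i j → entry-schur ρ t (splitAt m i) (splitAt m j))
      (expanded-isPMatrix P (setRow (t zero) ρ) (t ∘ suc)))

  module _ (q : BlockVector b) where

    affine : Vector Carrier n → BlockVector b
    affine z j i = sum (λ k → M j i k * z k) + q j i

    affine-cong : ∀ {z z′} → (∀ j → z j ≈ z′ j) → ∀ j i → affine z j i ≈ affine z′ j i
    affine-cong z≈ j i = +-congʳ (sum-cong-≋ (λ k → *-congˡ (z≈ k)))

    module _ (ρ : ∀ j → Fin (b j)) {m : ℕ} (t : Fin m → Row) where

      rhsEntry : Fin m ⊎ Fin n → Carrier
      rhsEntry (inj₁ p) = q (proj₁ (t p)) (proj₂ (t p)) - q (block t p) (ρ (block t p))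
      rhsEntry (inj₂ j) = q j (ρ j)

      expandedVector : Vector Carrier (m ℕ.+ n)
      expandedVector i = rhsEntry (splitAt m i)

      module _ (s : Fin m → Carrier) (z : Fin n → Carrier) where

        value : Fin m ⊎ Fin n → Carrier
        value x = sum (λ r → entry ρ t x (inj₁ r) * s r) + sum (λ k → entry ρ t x (inj₂ k) * z k) + rhsEntry x

        value-inj₁ : ∀ p → value (inj₁ p) ≈
          affine z (proj₁ (t p)) (proj₂ (t p)) - affine z (block t p) (ρ (block t p))
            + sum (λ r → lower (block t) p r * s r)
        value-inj₁ p = begin
          L + sum (λ k → (A k - B k) * z k) + (x - y)
            ≈⟨ +-congʳ (+-congˡ (trans (sum-cong-≋ (λ k →
                 solve 3 (λ a b z → (a :- b) :* z := a :* z :+ :- (b :* z)) ≈-refl (A k) (B k) (z k)))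
                 (trans (∑-distrib-+ (λ k → A k * z k) (λ k → - (B k * z k))) (+-congˡ (sum-neg (λ k → B k * z k)))))) ⟩
          L + (ΣA - ΣB) + (x - y)
            ≈⟨ solve 5 (λ l a b x y → l :+ (a :- b) :+ (x :- y) := a :+ x :- (b :+ y) :+ l) ≈-refl L ΣA ΣB x y ⟩
          ΣA + x - (ΣB + y) + L ∎
          where
          L = sum (λ r → lower (block t) p r * s r)
          A = M (proj₁ (t p)) (proj₂ (t p))
          B = M (block t p) (ρ (block t p))
          ΣA = sum (λ k → A k * z k)
          ΣB = sum (λ k → B k * z k)
          x = q (proj₁ (t p)) (proj₂ (t p))
          y = q (block t p) (ρ (block t p))

        value-inj₂ : ∀ j → value (inj₂ j) ≈ affine z j (ρ j) - sum (λ r → hit (block t r) j * s r)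
        value-inj₂ j = begin
          sum (λ r → - hit (block t r) j * s r) + Σ + y
            ≈⟨ +-congʳ (+-congʳ (trans (sum-cong-≋ (λ r → sym (-‿distribˡ-* (hit (block t r) j) (s r))))
                 (sum-neg (λ r → hit (block t r) j * s r)))) ⟩
          - H + Σ + y
            ≈⟨ solve 3 (λ h a y → :- h :+ a :+ y := a :+ y :- h) ≈-refl H Σ y ⟩
          Σ + y - H ∎
          where
          H = sum (λ r → hit (block t r) j * s r)
          Σ = sum (λ k → M j (ρ j) k * z k)
          y = q j (ρ j)

      product-expanded : ∀ (s : Fin (m ℕ.+ n) → Carrier) i →
        sum (λ k → expanded ρ t i k * s k) + expandedVector i ≈
        value (λ r → s (r ↑ˡ n)) (λ j → s (m ↑ʳ j)) (splitAt m i)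
      product-expanded s i = +-congʳ (trans (sum-split m (λ k → expanded ρ t i k * s k)) (+-cong
        (sum-cong-≋ (λ r → *-congʳ (reflexive (cong (entry ρ t (splitAt m i)) (Fin.splitAt-↑ˡ m r n)))))
        (sum-cong-≋ (λ j → *-congʳ (reflexive (cong (entry ρ t (splitAt m i)) (Fin.splitAt-↑ʳ m n j)))))))

      -- Every row of `M` must be listed, as the sign of its slack is controlled only through its
      -- item. `A` and `r` agree with the expanded data up to `≈`, which is all that computed memory
      -- contents offer.
      module _ (cover : ∀ j i → ∃ λ p → t p ≡ (j , i))
        (A : BlockMatrix (ones {m ℕ.+ n})) (r : BlockVector (ones {m ℕ.+ n}))
        (A≈ : ∀ i x k → A i x k ≈ expanded ρ t i k) (r≈ : ∀ i x → r i x ≈ expandedVector i) where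

        residual : ∀ z i x → sum (λ k → A i x k * z k) + r i x ≈
          value (λ p → z (p ↑ˡ n)) (λ j → z (m ↑ʳ j)) (splitAt m i)
        residual z i x = trans
          (+-cong (sum-cong-≋ (λ k → *-congʳ (A≈ i x k))) (r≈ i x))
          (product-expanded z i)

        rowValues : (Fin n → Carrier) → Fin m → Carrier
        rowValues z p = affine z (proj₁ (t p)) (proj₂ (t p))

        firsts : (Fin n → Carrier) → Fin n → Carrier
        firsts z j = affine z j (ρ j)

        module _ {w z} (S : IsSolution A r w z) where
          open IsSolution S

          private
            s τ : Fin m → Carrier
            s p = z (p ↑ˡ n)
            τ p = w (p ↑ˡ n) zero
            u y : Fin n → Carrier
            u j = w (m ↑ʳ j) zero
            y j = z (m ↑ʳ j)

            w≈value : ∀ i → w i zero ≈ value s y (splitAt m i)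
            w≈value i = begin
              w i zero
                ≈⟨ solve 2 (λ a b → a := b :+ (a :- b)) ≈-refl (w i zero) (sum (λ k → A i zero k * z k)) ⟩
              sum (λ k → A i zero k * z k) + (w i zero - sum (λ k → A i zero k * z k))
                ≈⟨ +-congˡ (equation i zero) ⟩
              sum (λ k → A i zero k * z k) + r i zero
                ≈⟨ residual z i zero ⟩
              value s y (splitAt m i) ∎

            complementary′ : ∀ i → z i * w i zero ≈ 0#
            complementary′ i = trans (*-congˡ (sym (*-identityʳ _))) (complementarity i)

            D : Descends (block t) (rowValues y) (firsts y) s τ u
            D = record
              { slack = λ p → trans (w≈value (p ↑ˡ n))
                  (trans (reflexive (cong (value s y) (Fin.splitAt-↑ˡ m p n))) (value-inj₁ s y p))
              ; final = λ j → trans (w≈value (m ↑ʳ j))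
                  (trans (reflexive (cong (value s y) (Fin.splitAt-↑ʳ m n j))) (value-inj₂ s y j))
              }

            C : Complementary s τ
            C = record
              { s≥0 = λ p → z-nonnegative (p ↑ˡ n) ; τ≥0 = λ p → w-nonnegative (p ↑ˡ n) zero
              ; sτ≈0 = λ p → complementary′ (p ↑ˡ n) }

            row≥0 : ∀ j i → 0# ≤ affine y j i
            row≥0 j i with cover j i
            ... | p , tp≡ji with final-below D C p
            ...   | d , d≥0 , v≈ = ≤-respʳ-≈
              (trans (sym v≈) (reflexive (cong (λ x → affine y (proj₁ x) (proj₂ x)) tp≡ji)))
              (+-nonnegative (w-nonnegative _ zero) d≥0)

            attained : ∀ j → ∃ λ i → u j ≈ affine y j i
            attained j with final-attained D C j
            ... | inj₁ u≈                 = ρ j , u≈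
            ... | inj₂ (p , refl , u≈)    = proj₂ (t p) , u≈

          -- `u j` lies below all row values of block j and equals one of them. The former makes the
          -- slacks nonnegative, the latter turns a vanishing `u j` into a vanishing product.
          solution : IsSolution M q (affine y) y
          solution = record
            { equation = λ j i → xyx⁻¹≈y (sum (λ k → M j i k * y k)) (q j i)
            ; w-nonnegative = row≥0
            ; z-nonnegative = λ j → z-nonnegative (m ↑ʳ j)
            ; complementarity = complementary
            }
            where
            complementary : ∀ j → y j * product (affine y j) ≈ 0#
            complementary j with *-integral (complementary′ (m ↑ʳ j))
            ... | inj₁ y≈0 = trans (*-congʳ y≈0) (zeroˡ _)
            ... | inj₂ u≈0 with attained j
            ...   | i , u≈ = trans (*-congˡ (product-zero (affine y j) i (trans (sym u≈) u≈0))) (zeroʳ _)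

        module _ {w z} (S : IsSolution M q w z) where
          open IsSolution S

          solution-affine : ∀ j i → w j i ≈ affine z j i
          solution-affine j i = begin
            w j i
              ≈⟨ solve 2 (λ a b → a := b :+ (a :- b)) ≈-refl (w j i) (sum (λ k → M j i k * z k)) ⟩
            sum (λ k → M j i k * z k) + (w j i - sum (λ k → M j i k * z k))
              ≈⟨ +-congˡ (equation j i) ⟩
            affine z j i ∎

          affine-nonnegative : ∀ j i → 0# ≤ affine z j i
          affine-nonnegative j i = ≤-respʳ-≈ (solution-affine j i) (w-nonnegative j i)

        module _ {w z} (S : IsSolution M q w z)
          (minimized : Minimized (block t) (rowValues z) (firsts z)) where
          open IsSolution S
          open Minimized minimized

          expandedZ : Fin (m ℕ.+ n) → Carrier
          expandedZ i = [ s , z ]′ (splitAt m i)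

          expandedW : BlockVector (ones {m ℕ.+ n})
          expandedW i _ = [ τ , u ]′ (splitAt m i)

          expandedZ-↑ʳ : ∀ j → expandedZ (m ↑ʳ j) ≈ z j
          expandedZ-↑ʳ j = reflexive (cong [ s , z ]′ (Fin.splitAt-↑ʳ m n j))

          private
            value-cong : ∀ {s s′ z z′} → (∀ p → s p ≈ s′ p) → (∀ j → z j ≈ z′ j) →
              ∀ x → value s z x ≈ value s′ z′ x
            value-cong s≈ z≈ x = +-congʳ (+-cong
              (sum-cong-≋ (λ p → *-congˡ (s≈ p))) (sum-cong-≋ (λ j → *-congˡ (z≈ j))))

            -- If the product over the block vanishes, so does one row value. This value is `u j`
            -- plus a nonnegative excess, and `u j` is nonnegative itself.
            zu≈0 : ∀ j → z j * u j ≈ 0#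
            zu≈0 j with *-integral (complementarity j)
            ... | inj₁ z≈0 = trans (*-congʳ z≈0) (zeroˡ _)
            ... | inj₂ Πw≈0 with product≈0 (w j) Πw≈0
            ...   | i , w≈0 with cover j i
            ...     | p , tp≡ji with final-below descends complementary p
            ...       | d , d≥0 , v≈ = trans (*-congˡ (x+y≈0⇒x≈0 (u≥0 j) d≥0 (begin
              u j + d                ≡⟨ cong (λ x → u (proj₁ x) + d) tp≡ji ⟨
              u (block t p) + d      ≈⟨ v≈ ⟨
              rowValues z p               ≡⟨ cong (λ x → affine z (proj₁ x) (proj₂ x)) tp≡ji ⟩
              affine z j i           ≈⟨ solution-affine S j i ⟨
              w j i                  ≈⟨ w≈0 ⟩
              0#                     ∎))) (zeroʳ _)

            [τ,u]≈value : ∀ x → [ τ , u ]′ x ≈ value s z x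
            [τ,u]≈value (inj₁ p) = trans (Descends.slack descends p) (sym (value-inj₁ s z p))
            [τ,u]≈value (inj₂ j) = trans (Descends.final descends j) (sym (value-inj₂ s z j))

            [,]-nonnegative : ∀ {f : Fin m → Carrier} {g : Fin n → Carrier} →
              (∀ p → 0# ≤ f p) → (∀ j → 0# ≤ g j) → ∀ x → 0# ≤ [ f , g ]′ x
            [,]-nonnegative f≥0 g≥0 (inj₁ p) = f≥0 p
            [,]-nonnegative f≥0 g≥0 (inj₂ j) = g≥0 j

            [,]-complementary : ∀ x → [ s , z ]′ x * ([ τ , u ]′ x * 1#) ≈ 0#
            [,]-complementary (inj₁ p) = trans (*-congˡ (*-identityʳ _)) (Complementary.sτ≈0 complementary p)
            [,]-complementary (inj₂ j) = trans (*-congˡ (*-identityʳ _)) (zu≈0 j)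

          expandedSolution : IsSolution A r expandedW expandedZ
          expandedSolution = record
            { equation = λ i x → begin
                expandedW i x - sum (λ k → A i x k * expandedZ k)
                  ≈⟨ +-congʳ (begin
                       expandedW i x
                         ≈⟨ [τ,u]≈value (splitAt m i) ⟩
                       value s z (splitAt m i)
                         ≈⟨ value-cong (λ p → reflexive (cong [ s , z ]′ (Fin.splitAt-↑ˡ m p n))) expandedZ-↑ʳ (splitAt m i) ⟨
                       value (λ p → expandedZ (p ↑ˡ n)) (λ j → expandedZ (m ↑ʳ j)) (splitAt m i)
                         ≈⟨ residual expandedZ i x ⟨
                       sum (λ k → A i x k * expandedZ k) + r i x ∎) ⟩
                sum (λ k → A i x k * expandedZ k) + r i x - sum (λ k → A i x k * expandedZ k)
                  ≈⟨ xyx⁻¹≈y (sum (λ k → A i x k * expandedZ k)) (r i x) ⟩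
                r i x ∎
            ; w-nonnegative = λ i _ → [,]-nonnegative (Complementary.τ≥0 complementary) u≥0 (splitAt m i)
            ; z-nonnegative = λ i → [,]-nonnegative (Complementary.s≥0 complementary) z-nonnegative (splitAt m i)
            ; complementarity = λ i → [,]-complementary (splitAt m i)
            }

        uniqueSolution : ∀ {w z} → IsUniqueSolution A r w z →
          IsUniqueSolution M q (affine (λ j → z (m ↑ʳ j))) (λ j → z (m ↑ʳ j))
        uniqueSolution {w} {z} (S , unique) = solution S , only
          where
          only : ∀ w₂ z₂ → IsSolution M q w₂ z₂ →
            (∀ j i → w₂ j i ≈ affine (λ j → z (m ↑ʳ j)) j i) × (∀ j → z₂ j ≈ z (m ↑ʳ j))
          only w₂ z₂ S₂ = (λ j i → trans (solution-affine S₂ j i) (affine-cong z₂≈z j i)) , z₂≈z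
            where
            minimized : Minimized (block t) (rowValues z₂) (firsts z₂)
            minimized = minimize (block t) (rowValues z₂) (firsts z₂)
              (λ p → affine-nonnegative S₂ (proj₁ (t p)) (proj₂ (t p))) (λ j → affine-nonnegative S₂ j (ρ j))
            z₂≈z : ∀ j → z₂ j ≈ z (m ↑ʳ j)
            -- The extension carries `z₂` unchanged in its last n coordinates, so uniqueness for the
            -- LCP is read off there.
            z₂≈z j = trans (sym (expandedZ-↑ʳ S₂ minimized j))
              (proj₂ (unique (expandedW S₂ minimized) (expandedZ S₂ minimized) (expandedSolution S₂ minimized))
                (m ↑ʳ j))

-- The two programs

-- Naturals [ 3 ], …, [ 6 ] are loop variables; [ 7 , p ] and [ 8 , p ] are the
-- block and the row within it that auxiliary variable p stands for, and [ 2 ]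
-- counts these variables.  The transformation leaves scalar [ 8 ] at 0 and
-- forms the entry -1 from it.
private
  n⟨⟩ j⟨⟩ i⟨⟩ p⟨⟩ r⟨⟩ m⟨⟩ : NatExp
  n⟨⟩ = cell (lit 0 ∷ [])
  m⟨⟩ = cell (lit 2 ∷ [])
  j⟨⟩ = cell (lit 3 ∷ [])
  i⟨⟩ = cell (lit 4 ∷ [])
  p⟨⟩ = cell (lit 5 ∷ [])
  r⟨⟩ = cell (lit 6 ∷ [])

  block⟨_⟩ row⟨_⟩ : NatExp → NatExp
  block⟨ e ⟩ = cell (lit 7 ∷ e ∷ [])
  row⟨ e ⟩   = cell (lit 8 ∷ e ∷ [])

indexBody index cellBody vectorBody fill transformation : Program
indexBody =
  lit 7 ∷ m⟨⟩ ∷ [] ≔ j⟨⟩ ⨾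
  lit 8 ∷ m⟨⟩ ∷ [] ≔ i⟨⟩ ⨾
  lit 2 ∷ []       ≔ m⟨⟩ ⊕ lit 1
index =
  for 3 below n⟨⟩ repeat
  for 4 below cell (lit 0 ∷ j⟨⟩ ∷ []) repeat
  indexBody

target : List NatExp
target = lit 2 ∷ p⟨⟩ ∷ r⟨⟩ ∷ []

-- The outer tests select one of the four cases of `entry`. Equality of blocks is decided by two
-- failing `<` tests; `⊖ m⟨⟩` turns a position into an original index, and row number 0 is the
-- starting row.
cellBody =
  ifNat p⟨⟩ < m⟨⟩
  then (ifNat r⟨⟩ < m⟨⟩
    then (ifNat p⟨⟩ < r⟨⟩ then target ← zero
      else (ifNat block⟨ p⟨⟩ ⟩ < block⟨ r⟨⟩ ⟩ then target ← zero
      else (ifNat block⟨ r⟨⟩ ⟩ < block⟨ p⟨⟩ ⟩ then target ← zero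
      else (target ← one))))
    else (target ← arith sub
           (lit 0 ∷ block⟨ p⟨⟩ ⟩ ∷ row⟨ p⟨⟩ ⟩ ∷ r⟨⟩ ⊖ m⟨⟩ ∷ [])
           (lit 0 ∷ block⟨ p⟨⟩ ⟩ ∷ lit 0 ∷ r⟨⟩ ⊖ m⟨⟩ ∷ [])))
  else (ifNat r⟨⟩ < m⟨⟩
    then (ifNat p⟨⟩ ⊖ m⟨⟩ < block⟨ r⟨⟩ ⟩ then target ← zero
      else (ifNat block⟨ r⟨⟩ ⟩ < p⟨⟩ ⊖ m⟨⟩ then target ← zero
      else (lit 9 ∷ [] ← one ⨾ target ← arith sub (lit 8 ∷ []) (lit 9 ∷ []))))
    else (target ← copy (lit 0 ∷ p⟨⟩ ⊖ m⟨⟩ ∷ lit 0 ∷ r⟨⟩ ⊖ m⟨⟩ ∷ [])))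

vectorBody =
  ifNat p⟨⟩ < m⟨⟩
  then (lit 3 ∷ p⟨⟩ ∷ [] ← arith sub
         (lit 1 ∷ block⟨ p⟨⟩ ⟩ ∷ row⟨ p⟨⟩ ⟩ ∷ [])
         (lit 1 ∷ block⟨ p⟨⟩ ⟩ ∷ lit 0 ∷ []))
  else (lit 3 ∷ p⟨⟩ ∷ [] ← copy (lit 1 ∷ p⟨⟩ ⊖ m⟨⟩ ∷ lit 0 ∷ []))

fill =
  for 5 below m⟨⟩ ⊕ n⟨⟩ repeat
  ((for 6 below m⟨⟩ ⊕ n⟨⟩ repeat cellBody) ⨾ vectorBody)

-- Throughout `fill` the cell [ 2 ] must hold m, the border between auxiliary and original
-- positions; it becomes the order only afterwards.
transformation = index ⨾ fill ⨾ lit 2 ∷ [] ≔ m⟨⟩ ⊕ n⟨⟩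

copyZ accumulate evaluateRow evaluate recovery : Program
-- Here [ 2 ] holds the order m + n, so `m⟨⟩ ⊖ n⟨⟩` evaluates to m, the offset of the original
-- variables.
copyZ = for 3 below n⟨⟩ repeat (lit 7 ∷ j⟨⟩ ∷ [] ← copy (lit 5 ∷ (m⟨⟩ ⊖ n⟨⟩) ⊕ j⟨⟩ ∷ []))
accumulate =
  lit 8 ∷ [] ← arith mul (lit 0 ∷ j⟨⟩ ∷ i⟨⟩ ∷ p⟨⟩ ∷ []) (lit 7 ∷ p⟨⟩ ∷ []) ⨾
  lit 9 ∷ [] ← arith add (lit 9 ∷ []) (lit 8 ∷ [])
evaluateRow =
  lit 9 ∷ [] ← copy (lit 1 ∷ j⟨⟩ ∷ i⟨⟩ ∷ []) ⨾
  (for 5 below n⟨⟩ repeat accumulate) ⨾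
  lit 6 ∷ j⟨⟩ ∷ i⟨⟩ ∷ [] ← copy (lit 9 ∷ [])
evaluate = for 3 below n⟨⟩ repeat for 4 below cell (lit 0 ∷ j⟨⟩ ∷ []) repeat evaluateRow
recovery = copyZ ⨾ evaluate

-- Reasoning about results and costs of programs

module PartialSums {a ℓ} (N : CommutativeMonoid a ℓ) where
  open CommutativeMonoid N using (Carrier; _≈_; _∙_; ε; assoc; comm; ∙-congˡ; reflexive)
    renaming (refl to ≈-refl; sym to ≈-sym; trans to ≈-trans)
  open import Algebra.Properties.CommutativeMonoid.Sum N using (sum)

  -- Stated for monoids because it describes two loops: counting rows block by block in ℕ, and
  -- accumulating a row product over scalars. The recursion works from the front, whereas a loop
  -- appends at the back; `partialSum-suc` bridges the two.
  partialSum : ∀ {n} → (Fin n → Carrier) → ℕ → Carrier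
  partialSum {zero}  f k       = ε
  partialSum {suc n} f zero    = ε
  partialSum {suc n} f (suc k) = f zero ∙ partialSum (f ∘ suc) k

  partialSum-zero : ∀ {n} (f : Fin n → Carrier) → partialSum f 0 ≡ ε
  partialSum-zero {zero}  f = refl
  partialSum-zero {suc n} f = refl

  partialSum-suc : ∀ {n} (f : Fin n → Carrier) k →
    partialSum f (suc (toℕ k)) ≈ partialSum f (toℕ k) ∙ f k
  partialSum-suc {suc n} f zero = ≈-trans (∙-congˡ (reflexive (partialSum-zero (f ∘ suc)))) (comm (f zero) ε)
  partialSum-suc {suc n} f (suc k) = ≈-trans (∙-congˡ (partialSum-suc (f ∘ suc) k))
    (≈-sym (assoc _ _ _))

  partialSum-all : ∀ {n} (f : Fin n → Carrier) → partialSum f n ≡ sum f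
  partialSum-all {zero}  f = refl
  partialSum-all {suc n} f = cong (f zero ∙_) (partialSum-all (f ∘ suc))

module ℕ-PartialSums = PartialSums ℕ.+-0-commutativeMonoid

<-or-≡ : ∀ {k} {i j : Fin k} → toℕ i ℕ.< suc (toℕ j) → toℕ i ℕ.< toℕ j ⊎ i ≡ j
<-or-≡ i≤j = Sum.map₂ Fin.toℕ-injective (ℕ.m≤n⇒m<n∨m≡n (ℕ.s≤s⁻¹ i≤j))

module Execution {c ℓ₁ ℓ₂} (F : OrderedField c ℓ₁ ℓ₂) where
  open Over F

  module _ {a} {A : Set a} (μ : List ℕ → A) where

    update-hit : ∀ {x y v} → x ≡ y → update μ x v y ≡ v
    update-hit {x} {y} x≡y with List.≡-dec ℕ._≟_ x y
    ... | yes _  = refl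
    ... | no x≢y = contradiction x≡y x≢y

    update-miss : ∀ {x y v} → x ≢ y → update μ x v y ≡ μ y
    update-miss {x} {y} x≢y with List.≡-dec ℕ._≟_ x y
    ... | yes x≡y = contradiction x≡y x≢y
    ... | no _    = refl

  at-toℕ : ∀ {a} {A : Set a} {n} (d : A) (v : Vector A n) i → at d v (toℕ i) ≡ v i
  at-toℕ d v zero    = refl
  at-toℕ d v (suc i) = at-toℕ d (v ∘ suc) i

  -- The loop rule wants one budget for all rounds, so a loop over a block is charged as if the
  -- block had m rows; the bound stays polynomial.
  size≤rows : ∀ {n} (b : Fin n → ℕ) j → b j ℕ.≤ rows b
  size≤rows b zero    = ℕ.m≤m+n _ _
  size≤rows b (suc j) = ℕ.m≤n⇒m≤o+n (b zero) (size≤rows (b ∘ suc) j)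

  -- A Hoare triple with a time budget, for one fixed initial state; preconditions become ordinary
  -- hypotheses.
  record Runs {a} (P : Program) (σ : State) (k : ℕ) (Φ : State → Set a) : Set a where
    constructor runs
    field
      cost≤ : cost P σ ℕ.≤ k
      post  : Φ (run P σ)
  open Runs public

  module _ {a} {Φ : State → Set a} where

    runs-weaken : ∀ {P σ k l} → k ℕ.≤ l → Runs P σ k Φ → Runs P σ l Φ
    runs-weaken k≤l (runs cost≤k φ) = runs (ℕ.≤-trans cost≤k k≤l) φ

    -- Any positive budget is accepted, so that branches of different length can share one bound.
    runs-assign : ∀ {x e σ k} → Φ (setScalar (evalAddr σ x) (evalScalar σ e) σ) →
      Runs (x ← e) σ (suc k) Φ
    runs-assign φ = runs (s≤s z≤n) φ

    runs-ifNat : ∀ {d e P Q σ k} →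
      (evalNat σ d ℕ.< evalNat σ e → Runs P σ k Φ) →
      (¬ evalNat σ d ℕ.< evalNat σ e → Runs Q σ k Φ) →
      Runs (ifNat d < e then P else Q) σ (suc k) Φ
    runs-ifNat {d} {e} {P} {Q} {σ} {k} yes-case no-case = runs (proj₁ both) (proj₂ both)
      where
      both : cost (ifNat d < e then P else Q) σ ℕ.≤ suc k × Φ (run (ifNat d < e then P else Q) σ)
      both with evalNat σ d ℕ.<ᵇ evalNat σ e | ℕ.<ᵇ-reflects-< (evalNat σ d) (evalNat σ e)
      ... | true  | ofʸ d<e = s≤s (cost≤ (yes-case d<e)) , post (yes-case d<e)
      ... | false | ofⁿ d≮e = s≤s (cost≤ (no-case d≮e)) , post (no-case d≮e)

    runs-⨾ : ∀ {b} {Ψ : State → Set b} {P Q σ k l} → Runs P σ k Ψ →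
      (∀ σ → Ψ σ → Runs Q σ l Φ) → Runs (P ⨾ Q) σ (k ℕ.+ l) Φ
    runs-⨾ {P = P} {σ = σ} (runs cost≤k ψ) Q-runs =
      runs (ℕ.+-mono-≤ cost≤k (cost≤ (Q-runs (run P σ) ψ))) (post (Q-runs (run P σ) ψ))

  -- `loop` has its last round outermost, hence the induction on the number `l` of completed rounds.
  -- Rounds are indexed by `Fin n` so that invariants can refer to blocks and rows. Each round costs
  -- its body plus 1.
  runs-loop : ∀ {a} {x P σ k n} (I : ℕ → State → Set a) → I 0 σ →
    (∀ (i : Fin n) σ → I (toℕ i) σ → Runs P (setNat (x ∷ []) (toℕ i) σ) k (I (suc (toℕ i)))) →
    ∀ l → l ℕ.≤ n → loopCost x P l σ ℕ.≤ l ℕ.* suc k × I l (loop x P l σ)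
  runs-loop I start round zero    l≤n = z≤n , start
  runs-loop {x = x} {P} {σ} {k} {n} I start round (suc l) l<n
    with runs-loop {x = x} {P} {σ} {k} I start round l (ℕ.<⇒≤ l<n)
  ... | cost≤k , inv =
    ℕ.≤-trans (ℕ.+-mono-≤ cost≤k (s≤s (cost≤ last))) (ℕ.≤-reflexive (ℕ.+-comm (l ℕ.* suc k) (suc k))) , post last
    where
    last : Runs P (setNat (x ∷ []) l (loop x P l σ)) k (I (suc l))
    last with Fin.fromℕ< l<n | Fin.toℕ-fromℕ< l<n
    ... | i | refl = round i (loop x P l σ) inv

  runs-for : ∀ {a} {x e P σ k n} (I : ℕ → State → Set a) → evalNat σ e ≡ n → I 0 σ →
    (∀ (i : Fin n) σ → I (toℕ i) σ → Runs P (setNat (x ∷ []) (toℕ i) σ) k (I (suc (toℕ i)))) →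
    Runs (for x below e repeat P) σ (suc (n ℕ.* suc k)) (I n)
  runs-for {x = x} {P = P} I refl start round with runs-loop {x = x} {P} I start round _ ℕ.≤-refl
  ... | cost≤k , inv = runs (s≤s cost≤k) inv

-- Correctness of the enumeration of rows

module Transformation {c ℓ₁ ℓ₂} (F : OrderedField c ℓ₁ ℓ₂)
  {n : ℕ} {b : Fin n → ℕ} (M : Over.BlockMatrix F b) (q : Over.BlockVector F b) where
  open OrderedField F using (Carrier)
  open Over F
  open Execution F
  open Reduction F M
  open ℕ-PartialSums

  Listed : State → Row → ℕ → Set
  Listed σ (j , i) p = nats σ (7 ∷ p ∷ []) ≡ toℕ j × nats σ (8 ∷ p ∷ []) ≡ toℕ i

  -- `input` equates whole memories because this phase writes naturals only. `sound` yields the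
  -- table of rows, and `covers` its surjectivity once all rows are done.
  record Indexed (m : ℕ) (Done : Row → Set) (σ : State) : Set c where
    field
      input   : scalars σ ≡ instanceScalars M q
      order   : nats σ (0 ∷ []) ≡ n
      sizes   : ∀ j → nats σ (0 ∷ toℕ j ∷ []) ≡ b j
      counter : nats σ (2 ∷ []) ≡ m
      sound   : ∀ p → p ℕ.< m → ∃ λ x → Listed σ x p
      covers  : ∀ x → Done x → ∃ λ p → p ℕ.< m × Listed σ x p

  before : ℕ → Row → Set
  before k (j , i) = toℕ j ℕ.< k

  within : Fin n → ℕ → Row → Set
  within j k (j′ , i) = toℕ j′ ℕ.< toℕ j ⊎ (j′ ≡ j × toℕ i ℕ.< k)

  runs-indexBody : ∀ {m} j i σ → Indexed m (within j (toℕ i)) σ × nats σ (3 ∷ []) ≡ toℕ j →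
    Runs indexBody (setNat (4 ∷ []) (toℕ i) σ) 3
      (λ σ → Indexed (suc m) (within j (suc (toℕ i))) σ × nats σ (3 ∷ []) ≡ toℕ j)
  runs-indexBody {m} j i σ (I , ν₃≡j) = runs ℕ.≤-refl (record
    { input   = input
    ; order   = order
    ; sizes   = sizes
    ; counter = ≡-trans (cong (ℕ._+ 1) counter) (ℕ.+-comm m 1)
    ; sound   = λ p p≤m → sound′ p (ℕ.m≤n⇒m<n∨m≡n (ℕ.s≤s⁻¹ p≤m))
    ; covers  = covers′
    } , ν₃≡j)
    where
    open Indexed I
    σ′ = run indexBody (setNat (4 ∷ []) (toℕ i) σ)
    -- New data goes to position m only, so every listed position below m survives.
    kept : ∀ {p} a v → p ℕ.< m →
      update (nats σ) (a ∷ nats σ (2 ∷ []) ∷ []) v (a ∷ p ∷ []) ≡ nats σ (a ∷ p ∷ [])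
    kept {p} a v p<m = update-miss (nats σ) {a ∷ nats σ (2 ∷ []) ∷ []} {a ∷ p ∷ []} {v}
      (λ eq → ℕ.<⇒≢ p<m (≡-trans (≡-sym (List.∷-injectiveˡ (List.∷-injectiveʳ eq))) counter))
    keep : ∀ {x p} → p ℕ.< m → Listed σ x p → Listed σ′ x p
    keep p<m (ν₇≡ , ν₈≡) = ≡-trans (kept 7 _ p<m) ν₇≡ , ≡-trans (kept 8 _ p<m) ν₈≡
    new : Listed σ′ (j , i) m
    new = ≡-trans (update-hit (nats σ) (cong (λ k → 7 ∷ k ∷ []) counter)) ν₃≡j
        , update-hit (nats σ) (cong (λ k → 8 ∷ k ∷ []) counter)
    sound′ : ∀ p → p ℕ.< m ⊎ p ≡ m → ∃ λ x → Listed σ′ x p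
    sound′ p (inj₁ p<m) with sound p p<m
    ... | x , l = x , keep p<m l
    sound′ p (inj₂ refl) = (j , i) , new
    old : ∀ x → within j (toℕ i) x → ∃ λ p → p ℕ.< suc m × Listed σ′ x p
    old x d with covers x d
    ... | p , p<m , l = p , ℕ.m<n⇒m<1+n p<m , keep p<m l
    covers′ : ∀ x → within j (suc (toℕ i)) x → ∃ λ p → p ℕ.< suc m × Listed σ′ x p
    covers′ x (inj₁ j′<j) = old x (inj₁ j′<j)
    covers′ (_ , i′) (inj₂ (refl , i′≤i)) with ℕ.m≤n⇒m<n∨m≡n (ℕ.s≤s⁻¹ i′≤i)
    ... | inj₁ i′<i = old (j , i′) (inj₂ (refl , i′<i))
    ... | inj₂ i′≡i with Fin.toℕ-injective i′≡i
    ...   | refl = m , ℕ.≤-refl , new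

  reindex : ∀ {m m′ D D′ σ} → m ≡ m′ → (∀ x → D′ x → D x) → Indexed m D σ → Indexed m′ D′ σ
  reindex refl D′⇒D I = record
    { input = input ; order = order ; sizes = sizes ; counter = counter ; sound = sound
    ; covers = λ x d → covers x (D′⇒D x d) }
    where open Indexed I

  indexed-setNat₃ : ∀ {m D σ} k → Indexed m D σ → Indexed m D (setNat (3 ∷ []) k σ)
  indexed-setNat₃ k I = record { Indexed I }

  runs-index : Runs index (initial M q) (1 ℕ.+ n ℕ.* (1 ℕ.+ (1 ℕ.+ rows b ℕ.* 4))) (Indexed (rows b) (λ _ → ⊤))
  runs-index = runs (cost≤ rounds) (reindex (partialSum-all b) (λ x _ → Fin.toℕ<n (proj₁ x)) (post rounds))
    where
    outer : ℕ → State → Set c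
    outer k = Indexed (partialSum b k) (before k)
    start : outer 0 (initial M q)
    start = record
      { input = refl ; order = refl ; sizes = at-toℕ 0 b ; counter = ≡-sym (partialSum-zero b)
      ; sound = λ p p<0 → contradiction (subst (p ℕ.<_) (partialSum-zero b) p<0) ℕ.n≮0
      ; covers = λ _ () }
    outer-round : ∀ j σ → outer (toℕ j) σ →
      Runs (for 4 below cell (lit 0 ∷ cell (lit 3 ∷ []) ∷ []) repeat indexBody) (setNat (3 ∷ []) (toℕ j) σ)
        (1 ℕ.+ rows b ℕ.* 4) (outer (suc (toℕ j)))
    outer-round j σ I = runs (ℕ.≤-trans (cost≤ inner-rounds) (s≤s (ℕ.*-monoˡ-≤ 4 (size≤rows b j))))
      (reindex (≡-sym (partialSum-suc b j)) done (proj₁ (post inner-rounds)))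
      where
      inner : ℕ → State → Set c
      inner k σ = Indexed (partialSum b (toℕ j) ℕ.+ k) (within j k) σ × nats σ (3 ∷ []) ≡ toℕ j
      inner-rounds : Runs (for 4 below cell (lit 0 ∷ cell (lit 3 ∷ []) ∷ []) repeat indexBody)
        (setNat (3 ∷ []) (toℕ j) σ) (1 ℕ.+ b j ℕ.* 4) (inner (b j))
      inner-rounds = runs-for inner (Indexed.sizes I j)
        (indexed-setNat₃ (toℕ j) (reindex (≡-sym (ℕ.+-identityʳ _)) (λ { x (inj₁ lt) → lt }) I) , refl)
        (λ i σ I → subst (λ k → Runs indexBody (setNat (4 ∷ []) (toℕ i) σ) 3
                            (λ σ → Indexed k (within j (suc (toℕ i))) σ × nats σ (3 ∷ []) ≡ toℕ j))
                     (≡-sym (ℕ.+-suc _ _)) (runs-indexBody j i σ I))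
      done : ∀ x → before (suc (toℕ j)) x → within j (b j) x
      done (j′ , i) j′≤j with ℕ.m≤n⇒m<n∨m≡n (ℕ.s≤s⁻¹ j′≤j)
      ... | inj₁ j′<j = inj₁ j′<j
      ... | inj₂ j′≡j with Fin.toℕ-injective j′≡j
      ...   | refl = inj₂ (refl , Fin.toℕ<n i)
    rounds : Runs index (initial M q) (1 ℕ.+ n ℕ.* (1 ℕ.+ (1 ℕ.+ rows b ℕ.* 4))) (outer n)
    rounds = runs-for outer refl start outer-round

-- Correctness of the matrix and right-hand side of the LCP

module Filling {c ℓ₁ ℓ₂} (F : OrderedField c ℓ₁ ℓ₂)
  {n : ℕ} {b : Fin n → ℕ} (M : Over.BlockMatrix F b) (q : Over.BlockVector F b)
  (ρ : ∀ j → Fin (b j)) (ρ≡0 : ∀ j → toℕ (ρ j) ≡ 0)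
  {m : ℕ} (t : Fin m → Reduction.Row F M) where
  open RingProperties F
  open Over F
  open Execution F
  open Reduction F M
  open Minima F {n}

  record Frame (σ : State) : Set c where
    field
      order   : nats σ (0 ∷ []) ≡ n
      counter : nats σ (2 ∷ []) ≡ m
      blocks  : ∀ p → nats σ (7 ∷ toℕ p ∷ []) ≡ toℕ (proj₁ (t p))
      indices : ∀ p → nats σ (8 ∷ toℕ p ∷ []) ≡ toℕ (proj₂ (t p))
      matrix  : ∀ j i k → scalars σ (0 ∷ toℕ j ∷ toℕ i ∷ toℕ k ∷ []) ≡ M j i k
      vector  : ∀ j i → scalars σ (1 ∷ toℕ j ∷ toℕ i ∷ []) ≡ q j i
      null    : scalars σ (8 ∷ []) ≡ 0#

  position : Fin m ⊎ Fin n → ℕ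
  position (inj₁ p) = toℕ p
  position (inj₂ j) = m ℕ.+ toℕ j

  toℕ-splitAt : ∀ i → toℕ i ≡ position (splitAt m i)
  toℕ-splitAt i = ≡-trans (cong toℕ (≡-sym (Fin.join-splitAt m n i))) (toℕ-join (splitAt m i))
    where
    toℕ-join : ∀ x → toℕ (Fin.join m n x) ≡ position x
    toℕ-join (inj₁ p) = Fin.toℕ-↑ˡ p n
    toℕ-join (inj₂ j) = Fin.toℕ-↑ʳ m j

  module _ (Cell : Fin (m ℕ.+ n) → Fin (m ℕ.+ n) → Set) (Entry : Fin (m ℕ.+ n) → Set) where

    -- `Cell` and `Entry` mark what has been written, so one record serves as invariant of both
    -- loops. Values agree up to `≈` because -1 is obtained as 0 - 1.
    record Filled (σ : State) : Set (c Level.⊔ ℓ₁) where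
      field
        frame   : Frame σ
        cells   : ∀ p r → Cell p r → scalars σ (2 ∷ toℕ p ∷ toℕ r ∷ []) ≈ expanded ρ t p r
        entries : ∀ p → Entry p → scalars σ (3 ∷ toℕ p ∷ []) ≈ expandedVector q ρ t p

  module _ {Cell Entry} {σ} (filled : Filled Cell Entry σ) where
    open Filled filled
    open Frame frame

    filled-narrow : ∀ {Cell′ Entry′} → (∀ p r → Cell′ p r → Cell p r) → (∀ p → Entry′ p → Entry p) →
      Filled Cell′ Entry′ σ
    filled-narrow C E = record
      { frame = frame ; cells = λ p r d → cells p r (C p r d) ; entries = λ p d → entries p (E p d) }

    -- The written address differs in its leading literal from every address that the invariant
    -- reads, so lookups compute past the update and all fields are reused. The other updates of
    -- scratch cells work alike.
    filled-setNat₅ : ∀ k → Filled Cell Entry (setNat (5 ∷ []) k σ)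
    filled-setNat₅ k = record { frame = record { Frame frame } ; cells = cells ; entries = entries }

    filled-setNat₆ : ∀ k → Filled Cell Entry (setNat (6 ∷ []) k σ)
    filled-setNat₆ k = record { frame = record { Frame frame } ; cells = cells ; entries = entries }

    filled-setScalar₉ : ∀ v → Filled Cell Entry (setScalar (9 ∷ []) v σ)
    filled-setScalar₉ v = record { frame = record { Frame frame } ; cells = cells ; entries = entries }

    filled-cell : ∀ {x v p r} → x ≡ 2 ∷ toℕ p ∷ toℕ r ∷ [] → v ≈ expanded ρ t p r →
      Filled (λ p′ r′ → Cell p′ r′ ⊎ (p′ ≡ p × r′ ≡ r)) Entry (setScalar x v σ)
    filled-cell {v = v} {p} {r} refl v≈ = record
      { frame = record { Frame frame } ; cells = cells′ ; entries = entries }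
      where
      cells′ : ∀ p′ r′ → Cell p′ r′ ⊎ (p′ ≡ p × r′ ≡ r) →
        update (scalars σ) (2 ∷ toℕ p ∷ toℕ r ∷ []) v (2 ∷ toℕ p′ ∷ toℕ r′ ∷ []) ≈ expanded ρ t p′ r′
      cells′ p′ r′ d with p Fin.≟ p′ | r Fin.≟ r′
      cells′ p′ r′ d | yes refl | yes refl =
        trans (reflexive (update-hit (scalars σ) {2 ∷ toℕ p ∷ toℕ r ∷ []} refl)) v≈
      cells′ p′ r′ (inj₁ d) | no p≢p′ | _ =
        trans (reflexive (update-miss (scalars σ) {2 ∷ toℕ p ∷ toℕ r ∷ []}
          (λ eq → p≢p′ (Fin.toℕ-injective (List.∷-injectiveˡ (List.∷-injectiveʳ eq)))))) (cells p′ r′ d)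
      cells′ p′ r′ (inj₁ d) | yes _ | no r≢r′ =
        trans (reflexive (update-miss (scalars σ) {2 ∷ toℕ p ∷ toℕ r ∷ []}
          (λ eq → r≢r′ (Fin.toℕ-injective (List.∷-injectiveˡ (List.∷-injectiveʳ (List.∷-injectiveʳ eq))))))) (cells p′ r′ d)
      cells′ p′ r′ (inj₂ (p′≡p , r′≡r)) | no p≢p′ | _       = contradiction (≡-sym p′≡p) p≢p′
      cells′ p′ r′ (inj₂ (p′≡p , r′≡r)) | yes _   | no r≢r′ = contradiction (≡-sym r′≡r) r≢r′

    filled-entry : ∀ {x v p} → x ≡ 3 ∷ toℕ p ∷ [] → v ≈ expandedVector q ρ t p →
      Filled Cell (λ p′ → Entry p′ ⊎ p′ ≡ p) (setScalar x v σ)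
    filled-entry {v = v} {p} refl v≈ = record
      { frame = record { Frame frame } ; cells = cells ; entries = entries′ }
      where
      entries′ : ∀ p′ → Entry p′ ⊎ p′ ≡ p →
        update (scalars σ) (3 ∷ toℕ p ∷ []) v (3 ∷ toℕ p′ ∷ []) ≈ expandedVector q ρ t p′
      entries′ p′ d with p Fin.≟ p′
      entries′ p′ d | yes refl = trans (reflexive (update-hit (scalars σ) {3 ∷ toℕ p ∷ []} refl)) v≈
      entries′ p′ (inj₁ d) | no p≢p′ =
        trans (reflexive (update-miss (scalars σ) {3 ∷ toℕ p ∷ []}
          (λ eq → p≢p′ (Fin.toℕ-injective (List.∷-injectiveˡ (List.∷-injectiveʳ eq)))))) (entries p′ d)
      entries′ p′ (inj₂ p′≡p) | no p≢p′ = contradiction (≡-sym p′≡p) p≢p′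

  module _ {Cell Entry} {σ} (filled : Filled Cell Entry σ) where
    open Filled filled
    open Frame frame

    module _ {p : Fin (m ℕ.+ n)} (ν₅≡p : nats σ (5 ∷ []) ≡ toℕ p) where

      private
        ν₅≡ : nats σ (5 ∷ []) ≡ position (splitAt m p)
        ν₅≡ = ≡-trans ν₅≡p (toℕ-splitAt p)

        auxiliary : ∀ {a x i} → splitAt m x ≡ inj₁ i → nats σ (a ∷ []) ≡ position (splitAt m x) →
          nats σ (a ∷ []) ℕ.< nats σ (2 ∷ [])
        auxiliary {i = i} x≡ ν≡ =
          subst₂ ℕ._<_ (≡-sym (≡-trans ν≡ (cong position x≡))) (≡-sym counter) (Fin.toℕ<n i)

        original : ∀ {a x j} → splitAt m x ≡ inj₂ j → nats σ (a ∷ []) ≡ position (splitAt m x) →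
          ¬ nats σ (a ∷ []) ℕ.< nats σ (2 ∷ [])
        original {j = j} x≡ ν≡ =
          ℕ.≤⇒≯ (subst₂ ℕ._≤_ (≡-sym counter) (≡-sym (≡-trans ν≡ (cong position x≡))) (ℕ.m≤m+n m (toℕ j)))

        offset : ∀ {a x j} → splitAt m x ≡ inj₂ j → nats σ (a ∷ []) ≡ position (splitAt m x) →
          nats σ (a ∷ []) ℕ.∸ nats σ (2 ∷ []) ≡ toℕ j
        offset {j = j} x≡ ν≡ =
          ≡-trans (cong₂ ℕ._∸_ (≡-trans ν≡ (cong position x≡)) counter) (ℕ.m+n∸m≡n m (toℕ j))

        blockAt : ∀ {a x i} → splitAt m x ≡ inj₁ i → nats σ (a ∷ []) ≡ position (splitAt m x) →
          nats σ (7 ∷ nats σ (a ∷ []) ∷ []) ≡ toℕ (block t i)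
        blockAt {i = i} x≡ ν≡ =
          ≡-trans (cong (λ k → nats σ (7 ∷ k ∷ [])) (≡-trans ν≡ (cong position x≡))) (blocks i)

        indexAt : ∀ {a x i} → splitAt m x ≡ inj₁ i → nats σ (a ∷ []) ≡ position (splitAt m x) →
          nats σ (8 ∷ nats σ (a ∷ []) ∷ []) ≡ toℕ (proj₂ (t i))
        indexAt {i = i} x≡ ν≡ =
          ≡-trans (cong (λ k → nats σ (8 ∷ k ∷ [])) (≡-trans ν≡ (cong position x≡))) (indices i)

        matrixAt : ∀ {x y z j i k} → x ≡ toℕ j → y ≡ toℕ i → z ≡ toℕ k →
          scalars σ (0 ∷ x ∷ y ∷ z ∷ []) ≡ M j i k
        matrixAt {j = j} {i} {k} refl refl refl = matrix j i k

        vectorAt : ∀ {x y j i} → x ≡ toℕ j → y ≡ toℕ i → scalars σ (1 ∷ x ∷ y ∷ []) ≡ q j i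
        vectorAt {j = j} {i} refl refl = vector j i

        differ : ∀ {x y} {i j : Fin n} → x ≡ toℕ i → y ≡ toℕ j → x ℕ.< y → i ≢ j
        differ x≡i y≡j x<y refl = ℕ.<⇒≢ x<y (≡-trans x≡i (≡-sym y≡j))

        agree : ∀ {x y} {i j : Fin n} → x ≡ toℕ i → y ≡ toℕ j → ¬ x ℕ.< y → ¬ y ℕ.< x → i ≡ j
        agree refl refl x≮y y≮x = Fin.toℕ-injective (ℕ.≤-antisym (ℕ.≮⇒≥ y≮x) (ℕ.≮⇒≥ x≮y))

      module _ {r : Fin (m ℕ.+ n)} (ν₆≡r : nats σ (6 ∷ []) ≡ toℕ r) where

        Cell′ : Fin (m ℕ.+ n) → Fin (m ℕ.+ n) → Set
        Cell′ p′ r′ = Cell p′ r′ ⊎ (p′ ≡ p × r′ ≡ r)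

        -- Splitting both positions mirrors the tests of the program and refutes the branches not
        -- taken. The budget 6 is reached by five tests and one assignment for two auxiliary
        -- positions, and by four tests and two assignments for the entry -1.
        runs-cellBody : Runs cellBody σ 6 (λ σ → Filled Cell′ Entry σ × nats σ (5 ∷ []) ≡ toℕ p)
        runs-cellBody = body (splitAt m p) (splitAt m r) refl refl
          where
          ν₆≡ : nats σ (6 ∷ []) ≡ position (splitAt m r)
          ν₆≡ = ≡-trans ν₆≡r (toℕ-splitAt r)
          address : 2 ∷ nats σ (5 ∷ []) ∷ nats σ (6 ∷ []) ∷ [] ≡ 2 ∷ toℕ p ∷ toℕ r ∷ []
          address = cong₂ (λ x y → 2 ∷ x ∷ y ∷ []) ν₅≡p ν₆≡r
          write : ∀ {e k x y} → splitAt m p ≡ x → splitAt m r ≡ y → evalScalar σ e ≈ entry ρ t x y →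
            Runs (target ← e) σ (suc k) (λ σ → Filled Cell′ Entry σ × nats σ (5 ∷ []) ≡ toℕ p)
          write p≡x r≡y e≈ = runs-assign
            (filled-cell filled address (trans e≈ (reflexive (cong₂ (entry ρ t) (≡-sym p≡x) (≡-sym r≡y)))) , ν₅≡p)
          body : ∀ x y → splitAt m p ≡ x → splitAt m r ≡ y →
            Runs cellBody σ 6 (λ σ → Filled Cell′ Entry σ × nats σ (5 ∷ []) ≡ toℕ p)
          body (inj₁ i) (inj₁ l) p≡x r≡y =
            runs-ifNat (λ _ → runs-ifNat
              (λ _ → runs-ifNat
                (λ p<r → write p≡x r≡y (sym (lower-< (block t)
                  (subst₂ ℕ._<_ (≡-trans ν₅≡ (cong position p≡x)) (≡-trans ν₆≡ (cong position r≡y)) p<r))))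
                (λ p≮r → runs-ifNat
                  (λ Jp<Jr → write p≡x r≡y (sym (lower-≢ (block t) {i} {l} (differ Jp Jr Jp<Jr))))
                  (λ Jp≮Jr → runs-ifNat
                    (λ Jr<Jp → write p≡x r≡y (sym (lower-≢ (block t) {i} {l} (differ Jr Jp Jr<Jp ∘ ≡-sym))))
                    (λ Jr≮Jp → write p≡x r≡y (sym (lower-≡ (block t) {i} {l}
                      (subst₂ ℕ._≤_ (≡-trans ν₆≡ (cong position r≡y)) (≡-trans ν₅≡ (cong position p≡x)) (ℕ.≮⇒≥ p≮r))
                      (agree Jp Jr Jp≮Jr Jr≮Jp)))))))
              (λ r≮m → contradiction (auxiliary r≡y ν₆≡) r≮m))
            (λ p≮m → contradiction (auxiliary p≡x ν₅≡) p≮m)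
            where
            Jp = blockAt {5} p≡x ν₅≡
            Jr = blockAt {6} r≡y ν₆≡
          body (inj₁ i) (inj₂ k) p≡x r≡y =
            runs-ifNat (λ _ → runs-ifNat
              (λ r<m → contradiction r<m (original r≡y ν₆≡))
              (λ _ → write p≡x r≡y (reflexive (cong₂ _-_
                (matrixAt Jp (indexAt {5} p≡x ν₅≡) (offset r≡y ν₆≡))
                (matrixAt Jp (≡-sym (ρ≡0 (block t i))) (offset r≡y ν₆≡))))))
            (λ p≮m → contradiction (auxiliary p≡x ν₅≡) p≮m)
            where Jp = blockAt {5} p≡x ν₅≡
          body (inj₂ j) (inj₁ l) p≡x r≡y =
            runs-ifNat (λ p<m → contradiction p<m (original p≡x ν₅≡))
            (λ _ → runs-ifNat
              (λ _ → runs-ifNat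
                (λ j<Jr → write p≡x r≡y (sym (-hit≈0 (differ jp Jr j<Jr ∘ ≡-sym))))
                (λ j≮Jr → runs-ifNat
                  (λ Jr<j → write p≡x r≡y (sym (-hit≈0 (differ Jr jp Jr<j))))
                  (λ Jr≮j → runs (s≤s (s≤s z≤n))
                    (filled-cell (filled-setScalar₉ filled 1#) address (minus-one (agree jp Jr j≮Jr Jr≮j)) , ν₅≡p))))
              (λ r≮m → contradiction (auxiliary r≡y ν₆≡) r≮m))
            where
            jp = offset {5} p≡x ν₅≡
            Jr = blockAt {6} r≡y ν₆≡
            -hit≈0 : ∀ {i j} → i ≢ j → - hit i j ≈ 0#
            -hit≈0 i≢j = trans (-‿cong (hit-≢ i≢j)) -0#≈0#
            minus-one : j ≡ block t l → scalars σ (8 ∷ []) - 1# ≈ expanded ρ t p r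
            minus-one j≡ = trans (+-congʳ (reflexive null)) (trans (+-identityˡ _) (sym (trans
              (reflexive (cong₂ (entry ρ t) p≡x r≡y))
              (-‿cong (trans (reflexive (cong (hit (block t l)) j≡)) (hit-refl (block t l)))))))
          body (inj₂ j) (inj₂ k) p≡x r≡y =
            runs-ifNat (λ p<m → contradiction p<m (original p≡x ν₅≡))
            (λ _ → runs-ifNat
              (λ r<m → contradiction r<m (original r≡y ν₆≡))
              (λ _ → write p≡x r≡y (reflexive
                (matrixAt (offset p≡x ν₅≡) (≡-sym (ρ≡0 j)) (offset r≡y ν₆≡)))))

      Entry′ : Fin (m ℕ.+ n) → Set
      Entry′ p′ = Entry p′ ⊎ p′ ≡ p

      runs-vectorBody : Runs vectorBody σ 2 (Filled Cell Entry′)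
      runs-vectorBody = body (splitAt m p) refl
        where
        write : ∀ {e x} → splitAt m p ≡ x → evalScalar σ e ≈ rhsEntry q ρ t x →
          Runs (lit 3 ∷ cell (lit 5 ∷ []) ∷ [] ← e) σ 1 (Filled Cell Entry′)
        write p≡x e≈ = runs-assign (filled-entry filled (cong (λ x → 3 ∷ x ∷ []) ν₅≡p)
          (trans e≈ (reflexive (cong (rhsEntry q ρ t) (≡-sym p≡x)))))
        body : ∀ x → splitAt m p ≡ x → Runs vectorBody σ 2 (Filled Cell Entry′)
        body (inj₁ i) p≡x =
          runs-ifNat (λ _ → write p≡x (reflexive (cong₂ _-_
              (vectorAt (blockAt {5} p≡x ν₅≡) (indexAt {5} p≡x ν₅≡))
              (vectorAt (blockAt {5} p≡x ν₅≡) (≡-sym (ρ≡0 (block t i)))))))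
            (λ p≮m → contradiction (auxiliary p≡x ν₅≡) p≮m)
        body (inj₂ j) p≡x =
          runs-ifNat (λ p<m → contradiction p<m (original p≡x ν₅≡))
            (λ _ → write p≡x (reflexive (vectorAt (offset p≡x ν₅≡) (≡-sym (ρ≡0 j)))))

  size : ∀ {σ} → Frame σ → nats σ (2 ∷ []) ℕ.+ nats σ (0 ∷ []) ≡ m ℕ.+ n
  size frame = cong₂ ℕ._+_ (Frame.counter frame) (Frame.order frame)

  rowsBelow : ℕ → Fin (m ℕ.+ n) → Set
  rowsBelow k p = toℕ p ℕ.< k

  cellsBelow : Fin (m ℕ.+ n) → ℕ → Fin (m ℕ.+ n) → Fin (m ℕ.+ n) → Set
  cellsBelow p k p′ r = toℕ p′ ℕ.< toℕ p ⊎ (p′ ≡ p × toℕ r ℕ.< k)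

  runs-fill : ∀ {σ} → Frame σ →
    Runs fill σ (1 ℕ.+ (m ℕ.+ n) ℕ.* (1 ℕ.+ ((1 ℕ.+ (m ℕ.+ n) ℕ.* 7) ℕ.+ 2)))
      (Filled (λ _ _ → ⊤) (λ _ → ⊤))
  runs-fill {σ} frame = runs (cost≤ rounds)
    (filled-narrow (post rounds) (λ p _ _ → Fin.toℕ<n p) (λ p _ → Fin.toℕ<n p))
    where
    outer : ℕ → State → Set (c Level.⊔ ℓ₁)
    outer k = Filled (λ p _ → rowsBelow k p) (rowsBelow k)
    outer-round : ∀ p σ → outer (toℕ p) σ →
      Runs ((for 6 below cell (lit 2 ∷ []) ⊕ cell (lit 0 ∷ []) repeat cellBody) ⨾ vectorBody)
        (setNat (5 ∷ []) (toℕ p) σ) ((1 ℕ.+ (m ℕ.+ n) ℕ.* 7) ℕ.+ 2) (outer (suc (toℕ p)))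
    outer-round p σ filled = runs-⨾
      (runs-for inner (size (Filled.frame filled))
        (filled-narrow (filled-setNat₅ filled (toℕ p)) (λ { _ _ (inj₁ p′<p) → p′<p }) (λ _ p′<p → p′<p) , refl)
        inner-round)
      (λ σ (filled , ν₅≡p) → let done = runs-vectorBody filled ν₅≡p in runs (cost≤ done)
        (filled-narrow (post done) (λ p′ r p′≤p → Sum.map₂ (λ p′≡p → p′≡p , Fin.toℕ<n r) (<-or-≡ p′≤p)) (λ p′ → <-or-≡)))
      where
      inner : ℕ → State → Set (c Level.⊔ ℓ₁)
      inner k σ = Filled (cellsBelow p k) (rowsBelow (toℕ p)) σ × nats σ (5 ∷ []) ≡ toℕ p
      inner-round : ∀ r σ → inner (toℕ r) σ → Runs cellBody (setNat (6 ∷ []) (toℕ r) σ) 6 (inner (suc (toℕ r)))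
      inner-round r σ (filled , ν₅≡p) = runs (cost≤ done)
        (filled-narrow (proj₁ (post done)) widen (λ _ p′<p → p′<p) , proj₂ (post done))
        where
        done = runs-cellBody (filled-setNat₆ filled (toℕ r)) ν₅≡p {r} refl
        widen : ∀ p′ r′ → cellsBelow p (suc (toℕ r)) p′ r′ → cellsBelow p (toℕ r) p′ r′ ⊎ (p′ ≡ p × r′ ≡ r)
        widen p′ r′ (inj₁ p′<p) = inj₁ (inj₁ p′<p)
        widen p′ r′ (inj₂ (p′≡p , r′≤r)) = Sum.map (λ r′<r → inj₂ (p′≡p , r′<r)) (p′≡p ,_) (<-or-≡ r′≤r)
    rounds : Runs fill σ (1 ℕ.+ (m ℕ.+ n) ℕ.* (1 ℕ.+ ((1 ℕ.+ (m ℕ.+ n) ℕ.* 7) ℕ.+ 2))) (outer (m ℕ.+ n))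
    rounds = runs-for outer (size frame) (record { frame = frame ; cells = λ _ _ () ; entries = λ _ () }) outer-round

-- Correctness of the recovery

module Recovery {c ℓ₁ ℓ₂} (F : OrderedField c ℓ₁ ℓ₂)
  {n : ℕ} {b : Fin n → ℕ} (M : Over.BlockMatrix F b) (q : Over.BlockVector F b)
  (m : ℕ) (y : Fin n → OrderedField.Carrier F) where
  open RingProperties F
  open Over F
  open Execution F
  open Reduction F M
  open PartialSums +-commutativeMonoid
  open Transformation F M q using (before; within)

  -- `z` is copied, hence exact; `w` is recomputed as M z + q with the summands in a different
  -- order, hence only up to `≈`.
  record Recovered (Z : Fin n → Set) (W : Row → Set) (σ : State) : Set (c Level.⊔ ℓ₁) where
    field
      order   : nats σ (0 ∷ []) ≡ n
      sizes   : ∀ j → nats σ (0 ∷ toℕ j ∷ []) ≡ b j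
      counter : nats σ (2 ∷ []) ≡ m ℕ.+ n
      matrix  : ∀ j i k → scalars σ (0 ∷ toℕ j ∷ toℕ i ∷ toℕ k ∷ []) ≡ M j i k
      vector  : ∀ j i → scalars σ (1 ∷ toℕ j ∷ toℕ i ∷ []) ≡ q j i
      given   : ∀ j → scalars σ (5 ∷ m ℕ.+ toℕ j ∷ []) ≡ y j
      z-done  : ∀ j → Z j → scalars σ (7 ∷ toℕ j ∷ []) ≡ y j
      w-done  : ∀ j i → W (j , i) → scalars σ (6 ∷ toℕ j ∷ toℕ i ∷ []) ≈ affine q y j i

  module _ {Z W σ} (R : Recovered Z W σ) where
    open Recovered R

    narrow : ∀ {Z′ W′} → (∀ j → Z′ j → Z j) → (∀ x → W′ x → W x) → Recovered Z′ W′ σ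
    narrow Z′⇒Z W′⇒W = record { Recovered R hiding (z-done; w-done)
      ; z-done = λ j d → z-done j (Z′⇒Z j d) ; w-done = λ j i d → w-done j i (W′⇒W (j , i) d) }

    setNat₃ : ∀ k → Recovered Z W (setNat (3 ∷ []) k σ)
    setNat₃ k = record { Recovered R }

    setNat₄ : ∀ k → Recovered Z W (setNat (4 ∷ []) k σ)
    setNat₄ k = record { Recovered R }

    setNat₅ : ∀ k → Recovered Z W (setNat (5 ∷ []) k σ)
    setNat₅ k = record { Recovered R }

    setScalar₈ : ∀ v → Recovered Z W (setScalar (8 ∷ []) v σ)
    setScalar₈ v = record { Recovered R }

    setScalar₉ : ∀ v → Recovered Z W (setScalar (9 ∷ []) v σ)
    setScalar₉ v = record { Recovered R }

    set-z : ∀ {x v j} → x ≡ 7 ∷ toℕ j ∷ [] → v ≡ y j → Recovered (λ j′ → Z j′ ⊎ j′ ≡ j) W (setScalar x v σ)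
    set-z {j = j} refl refl = record { Recovered R hiding (z-done) ; z-done = z-done′ }
      where
      z-done′ : ∀ j′ → Z j′ ⊎ j′ ≡ j → update (scalars σ) (7 ∷ toℕ j ∷ []) (y j) (7 ∷ toℕ j′ ∷ []) ≡ y j′
      z-done′ j′ d with j Fin.≟ j′
      z-done′ j′ d | yes refl = update-hit (scalars σ) {7 ∷ toℕ j ∷ []} refl
      z-done′ j′ (inj₁ d) | no j≢j′ = ≡-trans (update-miss (scalars σ) {7 ∷ toℕ j ∷ []}
        (λ eq → j≢j′ (Fin.toℕ-injective (List.∷-injectiveˡ (List.∷-injectiveʳ eq))))) (z-done j′ d)
      z-done′ j′ (inj₂ j′≡j) | no j≢j′ = contradiction (≡-sym j′≡j) j≢j′

    set-w : ∀ {x v j i} → x ≡ 6 ∷ toℕ j ∷ toℕ i ∷ [] → v ≈ affine q y j i →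
      Recovered Z (λ x → W x ⊎ x ≡ (j , i)) (setScalar x v σ)
    set-w {v = v} {j} {i} refl v≈ = record { Recovered R hiding (w-done) ; w-done = w-done′ }
      where
      addressed : ∀ j′ i′ → 6 ∷ toℕ j ∷ toℕ i ∷ [] ≡ 6 ∷ toℕ j′ ∷ toℕ i′ ∷ [] → (j′ , i′) ≡ (j , i)
      addressed j′ i′ eq with Fin.toℕ-injective {i = j} {j′} (List.∷-injectiveˡ (List.∷-injectiveʳ eq))
      ... | refl = cong (j ,_) (≡-sym (Fin.toℕ-injective (List.∷-injectiveˡ (List.∷-injectiveʳ (List.∷-injectiveʳ eq)))))
      w-done′ : ∀ j′ i′ → W (j′ , i′) ⊎ (j′ , i′) ≡ (j , i) →
        update (scalars σ) (6 ∷ toℕ j ∷ toℕ i ∷ []) v (6 ∷ toℕ j′ ∷ toℕ i′ ∷ []) ≈ affine q y j′ i′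
      w-done′ j′ i′ (inj₂ refl) = trans (reflexive (update-hit (scalars σ) {6 ∷ toℕ j ∷ toℕ i ∷ []} refl)) v≈
      w-done′ j′ i′ (inj₁ d) with List.≡-dec ℕ._≟_ (6 ∷ toℕ j ∷ toℕ i ∷ []) (6 ∷ toℕ j′ ∷ toℕ i′ ∷ [])
      ... | no eq≢ = trans (reflexive (update-miss (scalars σ) {6 ∷ toℕ j ∷ toℕ i ∷ []} eq≢)) (w-done j′ i′ d)
      ... | yes eq with addressed j′ i′ eq
      ...   | refl = trans (reflexive (update-hit (scalars σ) {6 ∷ toℕ j ∷ toℕ i ∷ []} refl)) v≈

  runs-copyZ : ∀ {σ} → Recovered (λ _ → ⊥) (λ _ → ⊥) σ →
    Runs copyZ σ (1 ℕ.+ n ℕ.* 2) (Recovered (λ _ → ⊤) (λ _ → ⊥))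
  runs-copyZ {σ} R = runs (cost≤ rounds) (narrow (post rounds) (λ j _ → Fin.toℕ<n j) (λ _ w → w))
    where
    inv : ℕ → State → Set (c Level.⊔ ℓ₁)
    inv k = Recovered (λ j → toℕ j ℕ.< k) (λ _ → ⊥)
    rounds : Runs copyZ σ (1 ℕ.+ n ℕ.* 2) (inv n)
    rounds = runs-for inv (Recovered.order R) (narrow R (λ _ ()) (λ _ w → w)) (λ j σ R →
      let open Recovered R in
      runs-assign (narrow
        (set-z (setNat₃ R (toℕ j)) refl (≡-trans (cong (λ k → scalars σ (5 ∷ k ℕ.+ toℕ j ∷ []))
          (≡-trans (cong₂ ℕ._∸_ counter order) (ℕ.m+n∸n≡m m n))) (given j)))
        (λ _ → <-or-≡) (λ _ w → w)))

  runs-evaluateRow : ∀ {W σ} j i → Recovered (λ _ → ⊤) W σ →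
    nats σ (3 ∷ []) ≡ toℕ j → nats σ (4 ∷ []) ≡ toℕ i →
    Runs evaluateRow σ (1 ℕ.+ ((1 ℕ.+ n ℕ.* 3) ℕ.+ 1))
      (λ σ → Recovered (λ _ → ⊤) (λ x → W x ⊎ x ≡ (j , i)) σ × nats σ (3 ∷ []) ≡ toℕ j)
  runs-evaluateRow {W} {σ} j i R ν₃ ν₄ = runs-⨾
    (runs-assign {Φ = inv 0} {k = 0} started) (λ σ I → runs-⨾ (summed I) (λ σ I → finish I))
    where
    f : Fin n → Carrier
    f k = M j i k * y k
    -- The accumulator starts at `q j i`, which therefore accompanies the partial sum in every
    -- round.
    inv : ℕ → State → Set (c Level.⊔ ℓ₁)
    inv k σ = Recovered (λ _ → ⊤) W σ × nats σ (3 ∷ []) ≡ toℕ j × nats σ (4 ∷ []) ≡ toℕ i ×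
      scalars σ (9 ∷ []) ≈ partialSum f k + q j i
    started : inv 0 (setScalar (9 ∷ []) (scalars σ (1 ∷ nats σ (3 ∷ []) ∷ nats σ (4 ∷ []) ∷ [])) σ)
    started = setScalar₉ R _ , ν₃ , ν₄ ,
      trans (reflexive (≡-trans (cong₂ (λ x y → scalars σ (1 ∷ x ∷ y ∷ [])) ν₃ ν₄) (Recovered.vector R j i)))
        (sym (trans (+-congʳ (reflexive (partialSum-zero f))) (+-identityˡ _)))
    summand : ∀ k σ → inv (toℕ k) σ → Runs accumulate (setNat (5 ∷ []) (toℕ k) σ) 2 (inv (suc (toℕ k)))
    summand k σ (R , ν₃ , ν₄ , acc) = runs ℕ.≤-refl
      (setScalar₉ (setScalar₈ (setNat₅ R (toℕ k)) _) _ , ν₃ , ν₄ , (begin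
        scalars σ (9 ∷ []) + scalars σ (0 ∷ nats σ (3 ∷ []) ∷ nats σ (4 ∷ []) ∷ toℕ k ∷ []) * scalars σ (7 ∷ toℕ k ∷ [])
          ≈⟨ +-cong acc (reflexive (cong₂ _*_
               (≡-trans (cong₂ (λ x y → scalars σ (0 ∷ x ∷ y ∷ toℕ k ∷ [])) ν₃ ν₄) (matrix j i k)) (z-done k tt))) ⟩
        partialSum f (toℕ k) + q j i + f k
          ≈⟨ solve 3 (λ a b c → a :+ b :+ c := a :+ c :+ b) ≈-refl (partialSum f (toℕ k)) (q j i) (f k) ⟩
        partialSum f (toℕ k) + f k + q j i
          ≈⟨ +-congʳ (partialSum-suc f k) ⟨
        partialSum f (suc (toℕ k)) + q j i ∎))
      where
      open Recovered R
      open SetoidReasoning setoid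
    summed : ∀ {σ} → inv 0 σ → Runs (for 5 below n⟨⟩ repeat accumulate) σ (1 ℕ.+ n ℕ.* 3) (inv n)
    summed I = runs-for inv (Recovered.order (proj₁ I)) I summand
    finish : ∀ {σ} → inv n σ → Runs (lit 6 ∷ j⟨⟩ ∷ i⟨⟩ ∷ [] ← copy (lit 9 ∷ [])) σ 1
      (λ σ → Recovered (λ _ → ⊤) (λ x → W x ⊎ x ≡ (j , i)) σ × nats σ (3 ∷ []) ≡ toℕ j)
    finish (R , ν₃ , ν₄ , acc) = runs-assign
      (set-w R (cong₂ (λ x y → 6 ∷ x ∷ y ∷ []) ν₃ ν₄) (trans acc (+-congʳ (reflexive (partialSum-all f)))) , ν₃)

  runs-evaluate : ∀ {σ} → Recovered (λ _ → ⊤) (λ _ → ⊥) σ →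
    Runs evaluate σ (1 ℕ.+ n ℕ.* (1 ℕ.+ (1 ℕ.+ rows b ℕ.* (1 ℕ.+ (1 ℕ.+ ((1 ℕ.+ n ℕ.* 3) ℕ.+ 1))))))
      (Recovered (λ _ → ⊤) (λ _ → ⊤))
  runs-evaluate {σ} R = runs (cost≤ rounds) (narrow (post rounds) (λ _ z → z) (λ x _ → Fin.toℕ<n (proj₁ x)))
    where
    C = 1 ℕ.+ ((1 ℕ.+ n ℕ.* 3) ℕ.+ 1)
    outer : ℕ → State → Set (c Level.⊔ ℓ₁)
    outer k = Recovered (λ _ → ⊤) (before k)
    outer-round : ∀ j σ → outer (toℕ j) σ →
      Runs (for 4 below cell (lit 0 ∷ j⟨⟩ ∷ []) repeat evaluateRow) (setNat (3 ∷ []) (toℕ j) σ)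
        (1 ℕ.+ rows b ℕ.* suc C) (outer (suc (toℕ j)))
    outer-round j σ R = runs-weaken (s≤s (ℕ.*-monoˡ-≤ (suc C) (size≤rows b j)))
      (runs (cost≤ inner-rounds) (narrow (proj₁ (post inner-rounds)) (λ _ z → z) done))
      where
      inner : ℕ → State → Set (c Level.⊔ ℓ₁)
      inner k σ = Recovered (λ _ → ⊤) (within j k) σ × nats σ (3 ∷ []) ≡ toℕ j
      inner-round : ∀ i σ → inner (toℕ i) σ → Runs evaluateRow (setNat (4 ∷ []) (toℕ i) σ) C (inner (suc (toℕ i)))
      inner-round i σ (R , ν₃) = runs (cost≤ row) (narrow (proj₁ (post row)) (λ _ z → z) widen , proj₂ (post row))
        where
        row = runs-evaluateRow j i (setNat₄ R (toℕ i)) ν₃ refl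
        widen : ∀ x → within j (suc (toℕ i)) x → within j (toℕ i) x ⊎ x ≡ (j , i)
        widen x (inj₁ j′<j) = inj₁ (inj₁ j′<j)
        widen x (inj₂ (refl , i′≤i)) = Sum.map (λ i′<i → inj₂ (refl , i′<i)) (cong (j ,_)) (<-or-≡ i′≤i)
      inner-rounds : Runs (for 4 below cell (lit 0 ∷ j⟨⟩ ∷ []) repeat evaluateRow) (setNat (3 ∷ []) (toℕ j) σ)
        (1 ℕ.+ b j ℕ.* suc C) (inner (b j))
      inner-rounds = runs-for inner (Recovered.sizes R j)
        (narrow (setNat₃ R (toℕ j)) (λ _ z → z) (λ { x (inj₁ j′<j) → j′<j }) , refl) inner-round
      done : ∀ x → before (suc (toℕ j)) x → within j (b j) x
      done (j′ , i) j′≤j = Sum.map₂ (λ { refl → refl , Fin.toℕ<n i }) (<-or-≡ j′≤j)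
    rounds : Runs evaluate σ _ (outer n)
    rounds = runs-for outer (Recovered.order R) (narrow R (λ _ z → z) (λ _ ())) outer-round

-- Polynomial bounds and assembly of the reduction

-- Built in the shape of the budgets that `runs-⨾` and `runs-for` compose, with `var₁` for m and
-- `var₂` for n, so that evaluation gives these budgets definitionally.
transformationBound recoveryBound : Poly
transformationBound =
  (con 1 ⊞ (var₂ ⊠ (con 1 ⊞ (con 1 ⊞ (var₁ ⊠ con 4)))))
  ⊞ ((con 1 ⊞ ((var₁ ⊞ var₂) ⊠ (con 1 ⊞ ((con 1 ⊞ ((var₁ ⊞ var₂) ⊠ con 7)) ⊞ con 2)))) ⊞ con 1)
recoveryBound =
  (con 1 ⊞ (var₂ ⊠ con 2))
  ⊞ (con 1 ⊞ (var₂ ⊠ (con 1 ⊞ (con 1 ⊞ (var₁ ⊠ (con 1 ⊞ (con 1 ⊞ ((con 1 ⊞ (var₂ ⊠ con 3)) ⊞ con 1))))))))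

module Correctness {c ℓ₁ ℓ₂} (F : OrderedField c ℓ₁ ℓ₂)
  {n : ℕ} {b : Fin n → ℕ} (b>0 : ∀ j → NonZero (b j))
  (M : Over.BlockMatrix F b) (q : Over.BlockVector F b) where
  open RingProperties F
  open Over F
  open Execution F
  open Reduction F M
  open Transformation F M q
  import Algebra.Properties.Monoid.Sum *-monoid as Product

  firstRow : ∀ j → Fin (b j)
  firstRow j = Fin.fromℕ< (ℕ.>-nonZero⁻¹ (b j) {{b>0 j}})

  firstRow≡0 : ∀ j → toℕ (firstRow j) ≡ 0
  firstRow≡0 j = Fin.toℕ-fromℕ< _

  private
    m = rows b

  Listed-injective : ∀ {σ x y p} → Listed σ x p → Listed σ y p → x ≡ y
  Listed-injective {x = j , _} {j′ , _} (j≡ , i≡) (j′≡ , i′≡)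
    with Fin.toℕ-injective {i = j} {j′} (≡-trans (≡-sym j≡) j′≡)
  ... | refl = cong (j ,_) (Fin.toℕ-injective (≡-trans (≡-sym i≡) i′≡))

  record Transformed (σ : State) : Set (c Level.⊔ ℓ₁) where
    field
      table   : Fin m → Row
      covered : ∀ j i → ∃ λ p → table p ≡ (j , i)
      order   : lcpOrder σ ≡ m ℕ.+ n
      cells   : ∀ p r → scalars σ (2 ∷ toℕ p ∷ toℕ r ∷ []) ≈ expanded firstRow table p r
      entries : ∀ p → scalars σ (3 ∷ toℕ p ∷ []) ≈ expandedVector q firstRow table p

  matrix-input : ∀ j i k → instanceScalars M q (0 ∷ toℕ j ∷ toℕ i ∷ toℕ k ∷ []) ≡ M j i k
  matrix-input j i k = ≡-trans (at-toℕ 0# _ j) (≡-trans (at-toℕ 0# _ i) (at-toℕ 0# _ k))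

  vector-input : ∀ j i → instanceScalars M q (1 ∷ toℕ j ∷ toℕ i ∷ []) ≡ q j i
  vector-input j i = ≡-trans (at-toℕ 0# _ j) (at-toℕ 0# _ i)

  runs-transformation : Runs transformation (initial M q) (evalPoly transformationBound m n) Transformed
  runs-transformation = runs-⨾ runs-index rest
    where
    rest : ∀ σ → Indexed m (λ _ → ⊤) σ →
      Runs (fill ⨾ lit 2 ∷ [] ≔ cell (lit 2 ∷ []) ⊕ cell (lit 0 ∷ [])) σ _ Transformed
    rest σ I = runs-⨾ (runs-fill frame) (λ σ filled → runs ℕ.≤-refl (record
      { table = table ; covered = covered ; order = size (Filled.frame filled)
      ; cells = λ p r → Filled.cells filled p r tt ; entries = λ p → Filled.entries filled p tt }))
      where
      open Indexed I
      table : Fin m → Row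
      table p = proj₁ (sound (toℕ p) (Fin.toℕ<n p))
      listed : ∀ p → Listed σ (table p) (toℕ p)
      listed p = proj₂ (sound (toℕ p) (Fin.toℕ<n p))
      covered : ∀ j i → ∃ λ p → table p ≡ (j , i)
      covered j i with covers (j , i) tt
      ... | p , p<m , l = Fin.fromℕ< p<m , Listed-injective {σ}
        (listed (Fin.fromℕ< p<m)) (subst (Listed σ (j , i)) (≡-sym (Fin.toℕ-fromℕ< p<m)) l)
      open Filling F M q firstRow firstRow≡0 table
      frame : Frame σ
      frame = record
        { order   = order
        ; counter = counter
        ; blocks  = proj₁ ∘ listed
        ; indices = proj₂ ∘ listed
        ; matrix  = λ j i k → ≡-trans (cong (λ s → s _) input) (matrix-input j i k)
        ; vector  = λ j i → ≡-trans (cong (λ s → s _) input) (vector-input j i)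
        ; null    = cong (λ s → s _) input
        }

  IsUniqueSolution-cong : ∀ {w w′ z z′} → (∀ j i → w j i ≈ w′ j i) → (∀ j → z j ≈ z′ j) →
    IsUniqueSolution M q w z → IsUniqueSolution M q w′ z′
  IsUniqueSolution-cong w≈ z≈ (S , unique) = record
    { equation = λ j i → trans (sym (+-cong (w≈ j i) (-‿cong (sum-cong-≋ (λ k → *-congˡ (z≈ k)))))) (equation j i)
    ; w-nonnegative = λ j i → ≤-respʳ-≈ (w≈ j i) (w-nonnegative j i)
    ; z-nonnegative = λ j → ≤-respʳ-≈ (z≈ j) (z-nonnegative j)
    ; complementarity = λ j → trans (sym (*-cong (z≈ j) (Product.sum-cong-≋ (w≈ j)))) (complementarity j)
    } , λ w₂ z₂ S₂ → let w₂≈ , z₂≈ = unique w₂ z₂ S₂ in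
      (λ j i → trans (w₂≈ j i) (w≈ j i)) , (λ j → trans (z₂≈ j) (z≈ j))
    where
    open IsSolution S
    open OrderProperties F using (≤-respʳ-≈)

  module _ {σ} (T : Transformed σ) where
    open Transformed T

    lcpMatrix-isBlockPMatrix : IsBlockPMatrix M → IsBlockPMatrix (lcpMatrix σ)
    lcpMatrix-isBlockPMatrix P _ = transport order (λ i k → scalars σ (2 ∷ i ∷ k ∷ [])) cells
      where
      -- The order is a memory lookup, so its equation cannot be matched directly. With an arbitrary
      -- order `N` and entries given by a function of numbers, it can.
      transport : ∀ {N} → N ≡ m ℕ.+ n → (f : ℕ → ℕ → Carrier) →
        (∀ p r → f (toℕ p) (toℕ r) ≈ expanded firstRow table p r) →
        IsPMatrix {N} (λ i k → f (toℕ i) (toℕ k))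
      transport refl f f≈ = PMatrix.isPMatrix-cong F (λ p r → sym (f≈ p r)) (expanded-isPMatrix P firstRow table)

    -- Reads by number with default 0, as the memory given to `recovery` does, and thus has a
    -- meaning before the order is known to be m + n.
    originalZ : ∀ {N} → Vector Carrier N → Vector Carrier n
    originalZ z j = at 0# z (m ℕ.+ toℕ j)

    originalZ-unique : ∀ {w z} → IsUniqueSolution (lcpMatrix σ) (lcpVector σ) w z →
      IsUniqueSolution M q (affine q (originalZ z)) (originalZ z)
    originalZ-unique = transport order
      (λ i k → scalars σ (2 ∷ i ∷ k ∷ [])) (λ i → scalars σ (3 ∷ i ∷ [])) cells entries
      where
      transport : ∀ {N} → N ≡ m ℕ.+ n → (f : ℕ → ℕ → Carrier) (g : ℕ → Carrier) →
        (∀ p r → f (toℕ p) (toℕ r) ≈ expanded firstRow table p r) →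
        (∀ p → g (toℕ p) ≈ expandedVector q firstRow table p) →
        ∀ {w z} → IsUniqueSolution {N} {ones} (λ i _ k → f (toℕ i) (toℕ k)) (λ i _ → g (toℕ i)) w z →
        IsUniqueSolution M q (affine q (originalZ z)) (originalZ z)
      transport refl f g f≈ g≈ {w} {z} S = IsUniqueSolution-cong
        (affine-cong q {z = λ j → z (m ↑ʳ j)} {originalZ z} (sym ∘ z≈)) (sym ∘ z≈)
        (uniqueSolution q firstRow table covered (λ i _ k → f (toℕ i) (toℕ k)) (λ i _ → g (toℕ i))
          (λ i _ → f≈ i) (λ i _ → g≈ i) S)
        where
        z≈ : ∀ j → originalZ z j ≈ z (m ↑ʳ j)
        z≈ j = reflexive (≡-trans (cong (at 0# z) (≡-sym (Fin.toℕ-↑ʳ m j))) (at-toℕ 0# z (m ↑ʳ j)))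

  runs-recovery : ∀ {N} → N ≡ m ℕ.+ n → ∀ (w′ : BlockVector (ones {N})) (z′ : Vector Carrier N) →
    Runs recovery (withSolution M q w′ z′) (evalPoly recoveryBound m n)
      (Recovery.Recovered F M q m (λ j → at 0# z′ (m ℕ.+ toℕ j)) (λ _ → ⊤) (λ _ → ⊤))
  runs-recovery N≡ w′ z′ = runs-⨾ (runs-copyZ start) (λ σ → runs-evaluate)
    where
    open Recovery F M q m (λ j → at 0# z′ (m ℕ.+ toℕ j))
    start : Recovered (λ _ → ⊥) (λ _ → ⊥) (withSolution M q w′ z′)
    start = record
      { order = refl ; sizes = at-toℕ 0 b ; counter = N≡ ; matrix = matrix-input ; vector = vector-input
      ; given = λ _ → refl ; z-done = λ _ () ; w-done = λ _ _ () }

theorem7p3 : ∀ {c ℓ₁ ℓ₂} (F : OrderedField c ℓ₁ ℓ₂) → let open Over F in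
    Σ[ T ∈ Program ] Σ[ R ∈ Program ] Σ[ p ∈ Poly ] Σ[ r ∈ Poly ]
    (∀ {n} (b : Fin n → ℕ) → (∀ j → NonZero (b j)) →
    (M : BlockMatrix b) (q : BlockVector b) → IsBlockPMatrix M →
    Transforms T p M q × Recovers T R r M q)
theorem7p3 F = transformation , recovery , transformationBound , recoveryBound ,
  λ b b>0 M q P →
    let open Correctness F b>0 M q
        open Execution F using (cost≤; post)
        T = runs-transformation
    in (cost≤ T , lcpMatrix-isBlockPMatrix (post T) P) ,
       λ w′ z′ S →
         let R = runs-recovery (Transformed.order (post T)) w′ z′
         in cost≤ R , IsUniqueSolution-cong
              (λ j i → RingProperties.sym F (Recovery.Recovered.w-done (post R) j i tt))
              (λ j → RingProperties.sym F (RingProperties.reflexive F (Recovery.Recovered.z-done (post R) j tt)))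
              (originalZ-unique (post T) S)
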